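{- Let $a\ge1$ be an integer and let $\alpha=a+\frac1{a+}\,\frac1{a+}\,\frac1{a+}\cdots=\frac12\left(a+\sqrt{a^2+4}\right)$. Let $p_m/q_m$ denote the regular continued fraction convergents of $\alpha$. Then for each sufficiently large positive integer $m$ there exists a $p\in(0,1)$ such that the initial $p$-convergent $r_0/s_0$ of $\alpha$ satisfies $r_0/s_0=p_m/q_m$.
   Context: Regular convergents: with all partial quotients $b_n=a$, $p_n=b_np_{n-1}+p_{n-2}$, $q_n=b_nq_{n-1}+q_{n-2}$ for $n\ge0$, with $p_{ -2}=0,p_{ -1}=1,q_{ -2}=1,q_{ -1}=0$. $p$-convergents (the convergents of the $p$-continued fraction): for $p\in(0,1)$, $F^{\langle p\rangle}(x,y)=(|x|^p+|y|^p)^{1/p}$, and for $t>0$, $F_t^{\langle p\rangle}(x,y)=F^{\langle p\rangle}(t^{ -1}x,ty)$. For $P\in\mathbb{R}^2$ put $\mathcal{B}_t(P)=\{P'\in\mathbb{R}^2: F_t^{\langle p\rangle}(P')<F_t^{\langle p\rangle}(P)\}$. A lattice is admissible for a set $S$ if the only lattice point inside $S$ is the origin. Let $L_\alpha=(0,1)\mathbb{Z}+(1,-\alpha)\mathbb{Z}$. Set $P_{ -1}=(0,1)$, $t_{ -1}=1$. Given $P_m$ and $t_m$ ($m\ge -1$), let $t_{m+1}$ be the largest $T\geq t_m$ such that $L_\alpha$ is admissible for $\mathcal{B}_t(P_m)$ for all $t\in[t_m,T]$, and let $P_{m+1}$ be the (unique) point of $L_\alpha$ with maximal $x$-coordinate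 among the finitely many $P'\in L_\alpha$ with $F^{\langle p\rangle}_{t_{m+1}}(P')=F^{\langle p\rangle}_{t_{m+1}}(P_m)$. Write $P_m=(x_m,y_m)$, $s_m=x_m$ and $r_m=y_m+x_m\alpha\in\mathbb{Z}$ for $m\ge0$. The $p$-convergents are $r_m/s_m$, $m\ge0$. -}

module Defs where

open import Level using (0ℓ; suc)
open import Algebra.Bundles using (CommutativeRing)
import Algebra.Properties.Monoid.Mult as Mult
open import Data.Integer.Base as ℤ using (ℤ; +_; -[1+_])
open import Data.Nat.Base as ℕ using (ℕ)
open import Data.Product.Base using (_×_; _,_; ∃; ∃₂; proj₁; proj₂)
open import Data.Product.Relation.Binary.Pointwise.NonDependent using (Pointwise)
open import Relation.Binary.Core using (Rel)
open import Relation.Binary.Definitions using (tri<; tri≈; tri>)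
open import Relation.Binary.Structures using (IsStrictTotalOrder)
import Relation.Binary.Construct.StrictToNonStrict as NonStrict
open import Relation.Nullary.Negation.Core using (¬_)
open import Relation.Unary using (Pred; _∈_; Satisfiable)

-- The real numbers as a Dedekind-complete ordered field together with real
-- powers.  Both are unique up to isomorphism: for x > 0, p ↦ x ^ p is the only
-- monotone homomorphism from the additive to the multiplicative group sending
-- 1 to x.  The order is decidable, as in classical analysis.

record RealNumbers : Set (suc 0ℓ) where
  infix  4 _<_ _≤_
  infixr 8 _^_
  infixl 7 _/_
  infix  9 _⁻¹
  field
    commutativeRing : CommutativeRing 0ℓ 0ℓ

  open CommutativeRing commutativeRing public

  field
    _<_                : Rel Carrier 0ℓ
    isStrictTotalOrder : IsStrictTotalOrder _≈_ _<_
    0<1                : 0# < 1#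
    +-monoˡ-<          : ∀ {x y} z → x < y → x + z < y + z
    *-pos              : ∀ {x y} → 0# < x → 0# < y → 0# < x * y

    -- Total, but unconstrained at 0 (apart from congruence).
    _⁻¹                : Carrier → Carrier
    ⁻¹-cong            : ∀ {x y} → x ≈ y → x ⁻¹ ≈ y ⁻¹
    ⁻¹-inverseʳ        : ∀ {x} → ¬ (x ≈ 0#) → x * x ⁻¹ ≈ 1#

  open IsStrictTotalOrder isStrictTotalOrder public using (compare)

  _≤_ : Rel Carrier 0ℓ
  _≤_ = NonStrict._≤_ _≈_ _<_

  _/_ : Carrier → Carrier → Carrier
  x / y = x * y ⁻¹

  UpperBound : Pred Carrier 0ℓ → Pred Carrier 0ℓ
  UpperBound S b = ∀ x → x ∈ S → x ≤ b

  field
    complete : (S : Pred Carrier 0ℓ) → Satisfiable S → Satisfiable (UpperBound S) →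
               ∃ λ b → UpperBound S b × (∀ c → UpperBound S c → b ≤ c)

    -- Only nonnegative bases, and at base 0 only positive exponents, are
    -- meaningful.
    _^_       : Carrier → Carrier → Carrier
    ^-cong    : ∀ {x y p q} → x ≈ y → p ≈ q → x ^ p ≈ y ^ q
    ^-zeroˡ   : ∀ {p} → 0# < p → 0# ^ p ≈ 0#
    ^-pos     : ∀ {x} p → 0# < x → 0# < x ^ p
    ^-one     : ∀ {x} → 0# < x → x ^ 1# ≈ x
    ^-+       : ∀ {x} p q → 0# < x → x ^ (p + q) ≈ x ^ p * x ^ q
    ^-*       : ∀ {x} p q → 0# < x → x ^ (p * q) ≈ (x ^ p) ^ q
    *-^       : ∀ {x y} p → 0# < x → 0# < y → (x * y) ^ p ≈ x ^ p * y ^ p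
    ^-monoˡ-< : ∀ {x y p} → 0# < p → 0# < x → x < y → x ^ p < y ^ p
    ^-monoʳ-< : ∀ {x p q} → 1# < x → p < q → x ^ p < x ^ q

  fromℕ : ℕ → Carrier
  fromℕ n = Mult._×_ +-monoid n 1#

  fromℤ : ℤ → Carrier
  fromℤ (+ n)    = fromℕ n
  fromℤ -[1+ n ] = - fromℕ (ℕ.suc n)

  ∣_∣ : Carrier → Carrier
  ∣ x ∣ with compare x 0#
  ... | tri< _ _ _ = - x
  ... | tri≈ _ _ _ = x
  ... | tri> _ _ _ = x

  √_ : Carrier → Carrier
  √ x = x ^ (1# / fromℕ 2)

-- Regular convergents with partial quotients b₀, b₁, …  The recurrences start
-- at index -2, so these sequences are shifted by two.

numerators denominators : (ℕ → ℕ) → ℕ → ℕ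

numerators b 0 = 0
numerators b 1 = 1
numerators b (ℕ.suc (ℕ.suc n)) =
  b n ℕ.* numerators b (ℕ.suc n) ℕ.+ numerators b n

denominators b 0 = 1
denominators b 1 = 0
denominators b (ℕ.suc (ℕ.suc n)) =
  b n ℕ.* denominators b (ℕ.suc n) ℕ.+ denominators b n

numerator denominator : (ℕ → ℕ) → ℕ → ℕ
numerator   b m = numerators   b (2 ℕ.+ m)
denominator b m = denominators b (2 ℕ.+ m)

module PContinuedFraction (ℝ : RealNumbers) where
  open RealNumbers ℝ
  infix 4 _≋_

  Point : Set
  Point = Carrier × Carrier

  _≋_ : Rel Point 0ℓ
  _≋_ = Pointwise _≈_ _≈_

  origin : Point
  origin = 0# , 0#

  F : Carrier → Point → Carrier
  F p (x , y) = (∣ x ∣ ^ p + ∣ y ∣ ^ p) ^ (1# / p)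

  F[_] : Carrier → Carrier → Point → Carrier
  F[ t ] p (x , y) = F p (t ⁻¹ * x , t * y)

  Ball : (p t : Carrier) → Point → Pred Point 0ℓ
  Ball p t P Q = F[ t ] p Q < F[ t ] p P

  -- u (0 , 1) + v (1 , -α) for integers u, v.
  Lattice : Carrier → Pred Point 0ℓ
  Lattice α P = ∃₂ λ (u v : ℤ) → P ≋ (fromℤ v , fromℤ u + fromℤ v * - α)

  Admissible : Pred Point 0ℓ → Pred Point 0ℓ → Set
  Admissible L S = origin ∈ S × (∀ P → P ∈ L → P ∈ S → P ≋ origin)

  AdmissibleUpTo : (p α t : Carrier) → Point → Pred Carrier 0ℓ
  AdmissibleUpTo p α t P T =
    t ≤ T × (∀ τ → t ≤ τ → τ ≤ T → Admissible (Lattice α) (Ball p τ P))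

  IsNextTime : (p α t : Carrier) → Point → Pred Carrier 0ℓ
  IsNextTime p α t P t′ =
    AdmissibleUpTo p α t P t′ × UpperBound (AdmissibleUpTo p α t P) t′

  OnBoundary : (p α t : Carrier) → Point → Pred Point 0ℓ
  OnBoundary p α t P Q = Q ∈ Lattice α × F[ t ] p Q ≈ F[ t ] p P

  IsNextPoint : (p α t′ : Carrier) → Point → Pred Point 0ℓ
  IsNextPoint p α t′ P P′ =
    P′ ∈ OnBoundary p α t′ P ×
    (∀ Q → Q ∈ OnBoundary p α t′ P →
       proj₁ Q ≤ proj₁ P′ × (proj₁ Q ≈ proj₁ P′ → Q ≋ P′))

  -- Reached p α n t P says that t = t_{n-1} and P = P_{n-1}: the sequence
  -- starts at index -1.
  data Reached (p α : Carrier) : ℕ → Carrier → Point → Set where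
    start : Reached p α 0 1# (0# , 1#)
    next  : ∀ {n t P t′ P′} → Reached p α n t P →
            IsNextTime p α t P t′ → IsNextPoint p α t′ P P′ →
            Reached p α (ℕ.suc n) t′ P′

  -- r / s is the p-convergent of α with index m.
  IsPConvergent : (p α : Carrier) → ℕ → (r s : ℤ) → Set
  IsPConvergent p α m r s = ∃₂ λ t P → Reached p α (ℕ.suc m) t P ×
    fromℤ s ≈ proj₁ P × fromℤ r ≈ proj₂ P + proj₁ P * α

  -- The value (a + √(a² + 4)) / 2 of the continued fraction with all partial
  -- quotients equal to a.
  metallicMean : ℕ → Carrier
  metallicMean a = (fromℕ a + √ (fromℕ (a ℕ.* a ℕ.+ 4))) / fromℕ 2

{-# OPTIONS --safe #-}

-- Put γ = α⁻¹, N = m + 1, and let p satisfy α ^ (N p) = 2.  Since P₋₁ = (0 , 1),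
-- the first p-convergent minimises |x|^p / (1 - |y|^p) over the lattice points
-- with x ≠ 0 and |y| < 1.  Among these |y| < γ ^ n forces |x| ≥ q_n, so only the
-- points (q_n , p_n - q_n α) compete, for which |y| = γ ^ (n + 1) and x is
-- nearly γ ^ (- n - 1) / (α + γ).  In terms of w = γ ^ ((n + 1) p) the quantity to
-- maximise is, up to an exponentially small error, a multiple of
-- 4 w (1 - w) = 1 - (1 - 2 w)².  It is largest for n = m, where w = 1/2; for every
-- other n it drops by at least 1/(4 N²), which exceeds the error for large N.
module Submission where

open import Defs
import Algebra.Properties.CommutativeSemiring.Exp as CommutativeExp
import Algebra.Properties.Monoid.Mult as Mult
import Algebra.Properties.Ring as RingProperties
import Algebra.Properties.Semiring.Exp as Exp
import Algebra.Properties.Semiring.Mult as SemiringMult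
import Algebra.Solver.Ring
open import Algebra.Solver.Ring.AlmostCommutativeRing
  using (fromCommutativeRing; _-Raw-AlmostCommutative⟶_)
open import Data.Empty using (⊥-elim)
open import Data.Integer.Base as ℤ using (ℤ; +_; -[1+_])
import Data.Integer.Properties as ℤ
import Data.Integer.Solver as ℤSolver
open import Data.Maybe.Base using (Maybe; just; nothing)
open import Data.Nat.Base as ℕ using (ℕ; zero; suc; z≤n; s≤s)
import Data.Nat.DivMod as ℕ
import Data.Nat.Properties as ℕ
open import Data.Nat.Tactic.RingSolver using (solve-∀)
open import Data.Product.Base using (_×_; _,_; proj₁; proj₂; ∃; ∃₂)
open import Data.Sum.Base using (_⊎_; inj₁; inj₂)
open import Function.Base using (const)
open import Level using (0ℓ)
open import Relation.Binary.Bundles using (StrictPartialOrder)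
open import Relation.Binary.Definitions using (tri<; tri≈; tri>)
import Relation.Binary.Properties.StrictPartialOrder
import Relation.Binary.PropositionalEquality as ≡
open ≡ using (_≡_; _≢_)
import Relation.Binary.Reasoning.StrictPartialOrder
open import Relation.Binary.Structures using (IsStrictTotalOrder)
open import Relation.Nullary.Decidable.Core using (yes; no)
open import Relation.Nullary.Negation.Core using (¬_)
open import Relation.Unary using (_∈_)

-- Multiplying F_t by t and raising to the power p turns membership in the ball around (0 , 1) into
-- |x|^p + t^(2p) |y|^p < t^(2p). A point with |y| < 1 therefore enters exactly when t^(2p) passes
-- |x|^p / (1 - |y|^p), which is where this quotient comes from. The difficulty is that p tends to 0
-- as N grows: the indices next to m lower 4 w (1 - w) only by an amount of order 1/N². The error
-- γ^(2n+2) is exponentially small in N only when n is comparable to N. For indices up to N/2 it can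
-- be as large as γ², but there w² is at least 1/2, so w is far from 1/2 and a crude constant bound
-- is enough. Hence the case split at N/2 and the two separate demands on N, a numerical one and a
-- growth one. The exponent p itself is a logarithm and has to be produced from completeness.

module RealArithmetic (ℝ : RealNumbers) where

  open RealNumbers ℝ

  -- Order relations on the reals.

  open IsStrictTotalOrder isStrictTotalOrder public
    using (isStrictPartialOrder; <-respʳ-≈; <-respˡ-≈)
    renaming (trans to <-trans; irrefl to <-irrefl)

  strictPartialOrder : StrictPartialOrder 0ℓ 0ℓ 0ℓ
  strictPartialOrder = record { isStrictPartialOrder = isStrictPartialOrder }

  open Relation.Binary.Properties.StrictPartialOrder strictPartialOrder public
    using (≤-respʳ-≈; ≤-respˡ-≈) renaming (trans to ≤-trans; antisym to ≤-antisym)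

  module ≤-Reasoning = Relation.Binary.Reasoning.StrictPartialOrder strictPartialOrder

  <-≤-trans : ∀ {x y z} → x < y → y ≤ z → x < z
  <-≤-trans x<y (inj₁ y<z) = <-trans x<y y<z
  <-≤-trans x<y (inj₂ y≈z) = <-respʳ-≈ y≈z x<y

  ≤-<-trans : ∀ {x y z} → x ≤ y → y < z → x < z
  ≤-<-trans (inj₁ x<y) y<z = <-trans x<y y<z
  ≤-<-trans (inj₂ x≈y) y<z = <-respˡ-≈ (sym x≈y) y<z

  ≤-refl : ∀ {x} → x ≤ x
  ≤-refl = inj₂ refl

  <⇒≱ : ∀ {x y} → x < y → ¬ (y ≤ x)
  <⇒≱ x<y y≤x = <-irrefl refl (<-≤-trans x<y y≤x)

  ≮⇒≥ : ∀ {x y} → ¬ (x < y) → y ≤ x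
  ≮⇒≥ {x} {y} x≮y with compare x y
  ... | tri< x<y _ _ = ⊥-elim (x≮y x<y)
  ... | tri≈ _ x≈y _ = inj₂ (sym x≈y)
  ... | tri> _ _ y<x = inj₁ y<x

  ≰⇒> : ∀ {x y} → ¬ (x ≤ y) → y < x
  ≰⇒> {x} {y} x≰y with compare x y
  ... | tri< x<y _ _ = ⊥-elim (x≰y (inj₁ x<y))
  ... | tri≈ _ x≈y _ = ⊥-elim (x≰y (inj₂ x≈y))
  ... | tri> _ _ y<x = y<x

  <-or-≥ : ∀ x y → x < y ⊎ y ≤ x
  <-or-≥ x y with compare x y
  ... | tri< x<y _ _ = inj₁ x<y
  ... | tri≈ _ x≈y _ = inj₂ (inj₂ (sym x≈y))
  ... | tri> _ _ y<x = inj₂ (inj₁ y<x)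

  -- Embedding of the integers, and a ring solver with integer coefficients.

  fromℕ-+ : ∀ m n → fromℕ (m ℕ.+ n) ≈ fromℕ m + fromℕ n
  fromℕ-+ = Mult.×-homo-+ +-monoid 1#

  fromℕ-* : ∀ m n → fromℕ (m ℕ.* n) ≈ fromℕ m * fromℕ n
  fromℕ-* = SemiringMult.×1-homo-* semiring

  module _ where
    open RingProperties ring
    open import Algebra.Properties.AbelianGroup +-abelianGroup using (⁻¹-∙-comm)
    open import Relation.Binary.Reasoning.Setoid setoid

    fromℤ-neg : ∀ i → fromℤ (ℤ.- i) ≈ - fromℤ i
    fromℤ-neg (+ zero)  = sym -0#≈0#
    fromℤ-neg (+ suc n) = refl
    fromℤ-neg -[1+ n ]  = sym (-‿involutive _)

    private
      cancel-1 : ∀ x y → x - y ≈ (1# + x) - (1# + y)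
      cancel-1 x y = begin
        x - y                     ≈⟨ +-congˡ (sym (+-identityˡ _)) ⟩
        x + (0# - y)              ≈⟨ +-congˡ (+-congʳ (sym (-‿inverseʳ 1#))) ⟩
        x + (1# - 1# - y)         ≈⟨ +-congˡ (+-assoc _ _ _) ⟩
        x + (1# + (- 1# - y))     ≈⟨ sym (+-assoc _ _ _) ⟩
        (x + 1#) + (- 1# - y)     ≈⟨ +-cong (+-comm _ _) (⁻¹-∙-comm _ _) ⟩
        (1# + x) - (1# + y)       ∎

      fromℤ-⊖ : ∀ m n → fromℤ (m ℤ.⊖ n) ≈ fromℕ m - fromℕ n
      fromℤ-⊖ m zero = sym (trans (+-congˡ -0#≈0#) (+-identityʳ _))
      fromℤ-⊖ zero (suc n) = sym (+-identityˡ _)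
      fromℤ-⊖ (suc m) (suc n) = begin
        fromℤ (suc m ℤ.⊖ suc n)    ≡⟨ ≡.cong fromℤ (ℤ.[1+m]⊖[1+n]≡m⊖n m n) ⟩
        fromℤ (m ℤ.⊖ n)            ≈⟨ fromℤ-⊖ m n ⟩
        fromℕ m - fromℕ n          ≈⟨ cancel-1 _ _ ⟩
        fromℕ (suc m) - fromℕ (suc n) ∎

    fromℤ-+ : ∀ i j → fromℤ (i ℤ.+ j) ≈ fromℤ i + fromℤ j
    fromℤ-+ (+ m)    (+ n)    = fromℕ-+ m n
    fromℤ-+ (+ m)    -[1+ n ] = fromℤ-⊖ m (suc n)
    fromℤ-+ -[1+ m ] (+ n)    = trans (fromℤ-⊖ n (suc m)) (+-comm _ _)
    fromℤ-+ -[1+ m ] -[1+ n ] = begin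
      - fromℕ (suc (suc (m ℕ.+ n)))        ≡⟨ ≡.cong (λ k → - fromℕ (suc k)) (≡.sym (ℕ.+-suc m n)) ⟩
      - fromℕ (suc m ℕ.+ suc n)            ≈⟨ -‿cong (fromℕ-+ (suc m) (suc n)) ⟩
      - (fromℕ (suc m) + fromℕ (suc n))    ≈⟨ sym (⁻¹-∙-comm _ _) ⟩
      - fromℕ (suc m) - fromℕ (suc n)      ∎

    private
      fromℤ-+* : ∀ m j → fromℤ (+ m ℤ.* j) ≈ fromℕ m * fromℤ j
      fromℤ-+* zero j = sym (zeroˡ _)
      fromℤ-+* (suc m) j = begin
        fromℤ (+ suc m ℤ.* j)         ≡⟨ ≡.cong fromℤ (ℤ.suc-* (+ m) j) ⟩
        fromℤ (j ℤ.+ + m ℤ.* j)       ≈⟨ fromℤ-+ j _ ⟩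
        fromℤ j + fromℤ (+ m ℤ.* j)   ≈⟨ +-cong (sym (*-identityˡ _)) (fromℤ-+* m j) ⟩
        1# * fromℤ j + fromℕ m * fromℤ j ≈⟨ sym (distribʳ _ _ _) ⟩
        fromℕ (suc m) * fromℤ j       ∎

    fromℤ-* : ∀ i j → fromℤ (i ℤ.* j) ≈ fromℤ i * fromℤ j
    fromℤ-* (+ m) j = fromℤ-+* m j
    fromℤ-* -[1+ m ] j = begin
      fromℤ (-[1+ m ] ℤ.* j)        ≡⟨ ≡.cong fromℤ (≡.sym (ℤ.neg-distribˡ-* (+ suc m) j)) ⟩
      fromℤ (ℤ.- (+ suc m ℤ.* j))   ≈⟨ fromℤ-neg (+ suc m ℤ.* j) ⟩
      - fromℤ (+ suc m ℤ.* j)       ≈⟨ -‿cong (fromℤ-+* (suc m) j) ⟩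
      - (fromℕ (suc m) * fromℤ j)   ≈⟨ -‿distribˡ-* _ _ ⟩
      - fromℕ (suc m) * fromℤ j     ∎

    private
      -- Unlike fromℤ, sends 1 to 1# definitionally, so that con (+ 1) denotes 1#.
      ⟦_⟧ℤ : ℤ → Carrier
      ⟦ + 1 ⟧ℤ = 1#
      ⟦ i   ⟧ℤ = fromℤ i

      ⟦⟧≈fromℤ : ∀ i → ⟦ i ⟧ℤ ≈ fromℤ i
      ⟦⟧≈fromℤ (+ 0)           = refl
      ⟦⟧≈fromℤ (+ 1)           = sym (+-identityʳ 1#)
      ⟦⟧≈fromℤ (+ suc (suc n)) = refl
      ⟦⟧≈fromℤ -[1+ n ]        = refl

      morphism : ℤ.+-*-rawRing -Raw-AlmostCommutative⟶ fromCommutativeRing commutativeRing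
      morphism = record
        { ⟦_⟧    = ⟦_⟧ℤ
        ; +-homo = λ i j → trans (⟦⟧≈fromℤ (i ℤ.+ j))
            (trans (fromℤ-+ i j) (sym (+-cong (⟦⟧≈fromℤ i) (⟦⟧≈fromℤ j))))
        ; *-homo = λ i j → trans (⟦⟧≈fromℤ (i ℤ.* j))
            (trans (fromℤ-* i j) (sym (*-cong (⟦⟧≈fromℤ i) (⟦⟧≈fromℤ j))))
        ; -‿homo = λ i → trans (⟦⟧≈fromℤ (ℤ.- i))
            (trans (fromℤ-neg i) (sym (-‿cong (⟦⟧≈fromℤ i))))
        ; 0-homo = refl
        ; 1-homo = refl
        }

      ⟦⟧-≟ : ∀ i j → Maybe (⟦ i ⟧ℤ ≈ ⟦ j ⟧ℤ)
      ⟦⟧-≟ i j with i ℤ.≟ j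
      ... | yes i≡j = just (reflexive (≡.cong ⟦_⟧ℤ i≡j))
      ... | no  _   = nothing

    -- Coefficients are taken in ℤ, where equality is decided by computation, so identities between
    -- numerals such as 17 = 1 + 8 · 2 are settled by the solver together with the polynomial ones.
    module Solver = Algebra.Solver.Ring ℤ.+-*-rawRing (fromCommutativeRing commutativeRing) morphism ⟦⟧-≟

  open Solver

  open Exp semiring public using ()
    renaming (_^_ to _^ℕ_; ^-congˡ to ^ℕ-congˡ; ^-homo-* to ^ℕ-+; ^-assocʳ to ^ℕ-*)
  open CommutativeExp commutativeSemiring public using () renaming (^-distrib-* to *-^ℕ)

  -- Inequalities in an ordered field.

  x<y⇒0<y-x : ∀ {x y} → x < y → 0# < y - x
  x<y⇒0<y-x {x} {y} x<y = <-respˡ-≈ (-‿inverseʳ x) (+-monoˡ-< (- x) x<y)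

  x≤y⇒0≤y-x : ∀ {x y} → x ≤ y → 0# ≤ y - x
  x≤y⇒0≤y-x (inj₁ x<y) = inj₁ (x<y⇒0<y-x x<y)
  x≤y⇒0≤y-x (inj₂ x≈y) = inj₂ (sym (trans (+-congˡ (-‿cong x≈y)) (-‿inverseʳ _)))

  -- Inequalities are derived by exhibiting the difference of the two sides as a
  -- sum of products of positive terms; the identity is left to the ring solver.
  <-from-diff : ∀ {x y e} → 0# < e → e ≈ y - x → x < y
  <-from-diff {x} {y} {e} 0<e e≈y-x =
    <-respˡ-≈ (+-identityˡ x) (<-respʳ-≈ y-x+x≈y (+-monoˡ-< x (<-respʳ-≈ e≈y-x 0<e)))
    where
    y-x+x≈y : y - x + x ≈ y
    y-x+x≈y = solve 2 (λ x y → y :- x :+ x := y) refl x y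

  ≤-from-diff : ∀ {x y e} → 0# ≤ e → e ≈ y - x → x ≤ y
  ≤-from-diff (inj₁ 0<e) eq = inj₁ (<-from-diff 0<e eq)
  ≤-from-diff {x} {y} {e} (inj₂ 0≈e) eq = inj₂ (begin
    x            ≈⟨ solve 2 (λ x y → x := y :- (y :- x)) refl x y ⟩
    y - (y - x)  ≈⟨ +-congˡ (-‿cong (trans (sym eq) (sym 0≈e))) ⟩
    y - 0#       ≈⟨ solve 1 (λ y → y :- con (+ 0) := y) refl y ⟩
    y            ∎)
    where open import Relation.Binary.Reasoning.Setoid setoid

  +-pos : ∀ {x y} → 0# < x → 0# < y → 0# < x + y
  +-pos {x} {y} 0<x 0<y = <-trans 0<y (<-from-diff 0<x (solve 2 (λ x y → x := x :+ y :- y) refl x y))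

  +-nonNeg : ∀ {x y} → 0# ≤ x → 0# ≤ y → 0# ≤ x + y
  +-nonNeg {x} {y} 0≤x 0≤y = ≤-trans 0≤y (≤-from-diff 0≤x (solve 2 (λ x y → x := x :+ y :- y) refl x y))

  +-pos-nonNeg : ∀ {x y} → 0# < x → 0# ≤ y → 0# < x + y
  +-pos-nonNeg {x} {y} 0<x 0≤y = ≤-<-trans 0≤y (<-from-diff 0<x (solve 2 (λ x y → x := x :+ y :- y) refl x y))

  *-nonNeg : ∀ {x y} → 0# ≤ x → 0# ≤ y → 0# ≤ x * y
  *-nonNeg (inj₁ 0<x) (inj₁ 0<y) = inj₁ (*-pos 0<x 0<y)
  *-nonNeg (inj₁ _)   (inj₂ 0≈y) = inj₂ (trans (sym (zeroʳ _)) (*-congˡ 0≈y))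
  *-nonNeg (inj₂ 0≈x) _          = inj₂ (trans (sym (zeroˡ _)) (*-congʳ 0≈x))

  neg-pos : ∀ {x} → x < 0# → 0# < - x
  neg-pos {x} x<0 = <-respʳ-≈ (solve 1 (λ x → con (+ 0) :- x := :- x) refl x) (x<y⇒0<y-x x<0)

  0<⇒≉0 : ∀ {x} → 0# < x → ¬ (x ≈ 0#)
  0<⇒≉0 0<x x≈0 = <-irrefl (sym x≈0) 0<x

  *-monoʳ-< : ∀ {x y} z → 0# < z → x < y → z * x < z * y
  *-monoʳ-< {x} {y} z 0<z x<y = <-from-diff (*-pos 0<z (x<y⇒0<y-x x<y))
    (solve 3 (λ x y z → z :* (y :- x) := z :* y :- z :* x) refl x y z)

  *-monoʳ-≤ : ∀ {x y} z → 0# ≤ z → x ≤ y → z * x ≤ z * y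
  *-monoʳ-≤ {x} {y} z 0≤z x≤y = ≤-from-diff (*-nonNeg 0≤z (x≤y⇒0≤y-x x≤y))
    (solve 3 (λ x y z → z :* (y :- x) := z :* y :- z :* x) refl x y z)

  *-mono-≤ : ∀ {x y z w} → 0# ≤ y → 0# ≤ z → x ≤ y → z ≤ w → x * z ≤ y * w
  *-mono-≤ {x} {y} {z} {w} 0≤y 0≤z x≤y z≤w =
    ≤-trans (≤-respˡ-≈ (*-comm z x) (≤-respʳ-≈ (*-comm z y) (*-monoʳ-≤ z 0≤z x≤y))) (*-monoʳ-≤ y 0≤y z≤w)

  *-cancelˡ-< : ∀ {x y} z → 0# < z → z * x < z * y → x < y
  *-cancelˡ-< {x} {y} z 0<z zx<zy with <-or-≥ x y
  ... | inj₁ x<y = x<y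
  ... | inj₂ y≤x = ⊥-elim (<⇒≱ zx<zy (*-monoʳ-≤ z (inj₁ 0<z) y≤x))

  *-cancelˡ-≤ : ∀ {x y} z → 0# < z → z * x ≤ z * y → x ≤ y
  *-cancelˡ-≤ {x} {y} z 0<z zx≤zy with <-or-≥ y x
  ... | inj₂ x≤y = x≤y
  ... | inj₁ y<x = ⊥-elim (<⇒≱ (*-monoʳ-< z 0<z y<x) zx≤zy)

  +-mono-≤ : ∀ {x y z w} → x ≤ y → z ≤ w → x + z ≤ y + w
  +-mono-≤ {x} {y} {z} {w} x≤y z≤w = ≤-from-diff (+-nonNeg (x≤y⇒0≤y-x x≤y) (x≤y⇒0≤y-x z≤w))
    (solve 4 (λ x y z w → y :- x :+ (w :- z) := y :+ w :- (x :+ z)) refl x y z w)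

  square-< : ∀ {x y} → 0# ≤ x → x < y → x * x < y * y
  square-< {x} {y} 0≤x x<y = <-from-diff
    (*-pos (x<y⇒0<y-x x<y) (<-respʳ-≈ (+-comm y x) (+-pos-nonNeg (≤-<-trans 0≤x x<y) 0≤x)))
    (solve 2 (λ x y → (y :- x) :* (x :+ y) := y :* y :- x :* x) refl x y)

  square-≤ : ∀ {x y} → 0# ≤ x → x ≤ y → x * x ≤ y * y
  square-≤ {x} {y} 0≤x x≤y = *-mono-≤ (≤-trans 0≤x x≤y) 0≤x x≤y x≤y

  square-cancel-< : ∀ {x y} → 0# ≤ y → x * x < y * y → x < y
  square-cancel-< {x} {y} 0≤y xx<yy with <-or-≥ x y
  ... | inj₁ x<y = x<y
  ... | inj₂ y≤x = ⊥-elim (<⇒≱ xx<yy (square-≤ 0≤y y≤x))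

  ⁻¹-inverseˡ : ∀ {x} → ¬ (x ≈ 0#) → x ⁻¹ * x ≈ 1#
  ⁻¹-inverseˡ x≉0 = trans (*-comm _ _) (⁻¹-inverseʳ x≉0)

  ⁻¹-pos : ∀ {x} → 0# < x → 0# < x ⁻¹
  ⁻¹-pos {x} 0<x = *-cancelˡ-< x 0<x
    (<-respˡ-≈ (sym (zeroʳ x)) (<-respʳ-≈ (sym (⁻¹-inverseʳ (0<⇒≉0 0<x))) 0<1))

  fromℕ-nonNeg : ∀ n → 0# ≤ fromℕ n
  fromℕ-nonNeg zero    = ≤-refl
  fromℕ-nonNeg (suc n) = +-nonNeg (inj₁ 0<1) (fromℕ-nonNeg n)

  fromℕ-pos : ∀ {n} → 1 ℕ.≤ n → 0# < fromℕ n
  fromℕ-pos {suc n} _ = +-pos-nonNeg 0<1 (fromℕ-nonNeg n)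

  fromℕ-mono-≤ : ∀ {m n} → m ℕ.≤ n → fromℕ m ≤ fromℕ n
  fromℕ-mono-≤ {n = n} z≤n = fromℕ-nonNeg n
  fromℕ-mono-≤ (s≤s m≤n) = +-mono-≤ ≤-refl (fromℕ-mono-≤ m≤n)

  fromℕ-mono-< : ∀ {m n} → m ℕ.< n → fromℕ m < fromℕ n
  fromℕ-mono-< {m} m<n = <-≤-trans
    (<-from-diff 0<1 (solve 1 (λ x → con (+ 1) := con (+ 1) :+ x :- x) refl (fromℕ m)))
    (fromℕ-mono-≤ m<n)

  fromℕ-1 : fromℕ 1 ≈ 1#
  fromℕ-1 = +-identityʳ 1#

  fromℤ-mono-≤ : ∀ {i j} → i ℤ.≤ j → fromℤ i ≤ fromℤ j
  fromℤ-mono-≤ (ℤ.-≤- {m} {n} n≤m) = ≤-from-diff (x≤y⇒0≤y-x (fromℕ-mono-≤ (s≤s n≤m)))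
    (solve 2 (λ x y → y :- x := :- x :- (:- y)) refl (fromℕ (suc n)) (fromℕ (suc m)))
  fromℤ-mono-≤ (ℤ.-≤+ {m} {n}) = ≤-from-diff (+-nonNeg (fromℕ-nonNeg (suc m)) (fromℕ-nonNeg n))
    (solve 2 (λ x y → x :+ y := y :- (:- x)) refl (fromℕ (suc m)) (fromℕ n))
  fromℤ-mono-≤ (ℤ.+≤+ m≤n) = fromℕ-mono-≤ m≤n

  fromℤ-cancel-< : ∀ {i j} → fromℤ i < fromℤ j → i ℤ.< j
  fromℤ-cancel-< {i} {j} i<j = ℤ.≰⇒> (λ j≤i → <⇒≱ i<j (fromℤ-mono-≤ j≤i))

  -- Powers with natural exponents.

  ^ℕ-pos : ∀ {x} n → 0# < x → 0# < x ^ℕ n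
  ^ℕ-pos zero    0<x = 0<1
  ^ℕ-pos (suc n) 0<x = *-pos 0<x (^ℕ-pos n 0<x)

  1^ℕ : ∀ n → 1# ^ℕ n ≈ 1#
  1^ℕ zero    = refl
  1^ℕ (suc n) = trans (*-identityˡ _) (1^ℕ n)

  ^ℕ-nonNeg : ∀ {x} n → 0# ≤ x → 0# ≤ x ^ℕ n
  ^ℕ-nonNeg zero    0≤x = inj₁ 0<1
  ^ℕ-nonNeg (suc n) 0≤x = *-nonNeg 0≤x (^ℕ-nonNeg n 0≤x)

  ^ℕ-monoˡ-≤ : ∀ {x y} n → 0# ≤ x → x ≤ y → x ^ℕ n ≤ y ^ℕ n
  ^ℕ-monoˡ-≤ zero    0≤x x≤y = ≤-refl
  ^ℕ-monoˡ-≤ (suc n) 0≤x x≤y = *-mono-≤ (≤-trans 0≤x x≤y) (^ℕ-nonNeg n 0≤x) x≤y (^ℕ-monoˡ-≤ n 0≤x x≤y)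

  1≤^ℕ : ∀ {x} n → 1# ≤ x → 1# ≤ x ^ℕ n
  1≤^ℕ n 1≤x = ≤-respˡ-≈ (1^ℕ n) (^ℕ-monoˡ-≤ n (inj₁ 0<1) 1≤x)

  ^ℕ≤1 : ∀ {x} n → 0# ≤ x → x ≤ 1# → x ^ℕ n ≤ 1#
  ^ℕ≤1 n 0≤x x≤1 = ≤-respʳ-≈ (1^ℕ n) (^ℕ-monoˡ-≤ n 0≤x x≤1)

  ^ℕ-monoʳ-≤ : ∀ {x m n} → 1# ≤ x → m ℕ.≤ n → x ^ℕ m ≤ x ^ℕ n
  ^ℕ-monoʳ-≤ {n = n} 1≤x z≤n = 1≤^ℕ n 1≤x
  ^ℕ-monoʳ-≤ {x} 1≤x (s≤s m≤n) = *-monoʳ-≤ x (≤-trans (inj₁ 0<1) 1≤x) (^ℕ-monoʳ-≤ 1≤x m≤n)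

  ^ℕ-antiʳ-≤ : ∀ {x m n} → 0# ≤ x → x ≤ 1# → m ℕ.≤ n → x ^ℕ n ≤ x ^ℕ m
  ^ℕ-antiʳ-≤ {n = n} 0≤x x≤1 z≤n = ^ℕ≤1 n 0≤x x≤1
  ^ℕ-antiʳ-≤ {x} 0≤x x≤1 (s≤s m≤n) = *-monoʳ-≤ x 0≤x (^ℕ-antiʳ-≤ 0≤x x≤1 m≤n)

  -- The induction step adds n (1 - x)², which is nonnegative on either side of 1. The inequality is
  -- used both above 1, for a power of α^p, and below 1, for γ^p.
  bernoulli : ∀ {x} n → 0# ≤ x → 1# - fromℕ n * (1# - x) ≤ x ^ℕ n
  bernoulli {x} zero 0≤x = inj₂ (solve 1 (λ x → con (+ 1) :- con (+ 0) :* (con (+ 1) :- x) := con (+ 1)) refl x)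
  bernoulli {x} (suc n) 0≤x = ≤-from-diff
    (+-nonNeg (*-nonNeg 0≤x (x≤y⇒0≤y-x (bernoulli n 0≤x))) (*-nonNeg (fromℕ-nonNeg n) square))
    (solve 3 (λ x N X → x :* (X :- (con (+ 1) :- N :* (con (+ 1) :- x))) :+ N :* ((con (+ 1) :- x) :* (con (+ 1) :- x))
       := x :* X :- (con (+ 1) :- (con (+ 1) :+ N) :* (con (+ 1) :- x))) refl x (fromℕ n) (x ^ℕ n))
    where
    square : 0# ≤ (1# - x) * (1# - x)
    square with <-or-≥ x 1#
    ... | inj₁ x<1 = inj₁ (*-pos (x<y⇒0<y-x x<1) (x<y⇒0<y-x x<1))
    ... | inj₂ 1≤x = ≤-respʳ-≈ (solve 1 (λ x → (x :- con (+ 1)) :* (x :- con (+ 1)) := (con (+ 1) :- x) :* (con (+ 1) :- x)) refl x)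
                       (*-nonNeg (x≤y⇒0≤y-x 1≤x) (x≤y⇒0≤y-x 1≤x))

  -- Powers with real exponents.

  *-cancelˡ-≈ : ∀ {x y} z → 0# < z → z * x ≈ z * y → x ≈ y
  *-cancelˡ-≈ z 0<z eq = ≤-antisym (*-cancelˡ-≤ z 0<z (inj₂ eq)) (*-cancelˡ-≤ z 0<z (inj₂ (sym eq)))

  ^-0# : ∀ {x} → 0# < x → x ^ 0# ≈ 1#
  ^-0# {x} 0<x = *-cancelˡ-≈ (x ^ 1#) (^-pos 1# 0<x)
    (trans (sym (^-+ 1# 0# 0<x)) (trans (^-cong refl (+-identityʳ 1#)) (sym (*-identityʳ _))))

  1^ : ∀ p → 1# ^ p ≈ 1#
  1^ p = *-cancelˡ-≈ (1# ^ p) (^-pos p 0<1)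
    (trans (sym (*-^ p 0<1 0<1)) (trans (^-cong (*-identityˡ 1#) refl) (sym (*-identityʳ _))))

  ^-nonNeg : ∀ {x p} → 0# < p → 0# ≤ x → 0# ≤ x ^ p
  ^-nonNeg 0<p (inj₁ 0<x) = inj₁ (^-pos _ 0<x)
  ^-nonNeg 0<p (inj₂ 0≈x) = inj₂ (sym (trans (^-cong (sym 0≈x) refl) (^-zeroˡ 0<p)))

  ^-mono-< : ∀ {x y p} → 0# < p → 0# ≤ x → x < y → x ^ p < y ^ p
  ^-mono-< 0<p (inj₁ 0<x) x<y = ^-monoˡ-< 0<p 0<x x<y
  ^-mono-< 0<p (inj₂ 0≈x) x<y = <-respˡ-≈ (sym (trans (^-cong (sym 0≈x) refl) (^-zeroˡ 0<p)))
    (^-pos _ (<-respˡ-≈ (sym 0≈x) x<y))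

  ^-mono-≤ : ∀ {x y p} → 0# < p → 0# ≤ x → x ≤ y → x ^ p ≤ y ^ p
  ^-mono-≤ 0<p 0≤x (inj₁ x<y) = inj₁ (^-mono-< 0<p 0≤x x<y)
  ^-mono-≤ 0<p 0≤x (inj₂ x≈y) = inj₂ (^-cong x≈y refl)

  ^-cancel-< : ∀ {x y p} → 0# < p → 0# ≤ y → x ^ p < y ^ p → x < y
  ^-cancel-< {x} {y} 0<p 0≤y fx<fy with <-or-≥ x y
  ... | inj₁ x<y = x<y
  ... | inj₂ y≤x = ⊥-elim (<⇒≱ fx<fy (^-mono-≤ 0<p 0≤y y≤x))

  ^-cancel-≈ : ∀ {x y p} → 0# < p → 0# ≤ x → 0# ≤ y → x ^ p ≈ y ^ p → x ≈ y
  ^-cancel-≈ {x} {y} 0<p 0≤x 0≤y eq with compare x y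
  ... | tri< x<y _ _ = ⊥-elim (<-irrefl eq (^-mono-< 0<p 0≤x x<y))
  ... | tri≈ _ x≈y _ = x≈y
  ... | tri> _ _ y<x = ⊥-elim (<-irrefl (sym eq) (^-mono-< 0<p 0≤y y<x))

  -- Coordinates of lattice points may vanish, whereas `*-^` speaks of positive bases; at y = 0 both
  -- sides are 0 because p > 0.
  *-^-nonNeg : ∀ {x y p} → 0# < p → 0# < x → 0# ≤ y → (x * y) ^ p ≈ x ^ p * y ^ p
  *-^-nonNeg 0<p 0<x (inj₁ 0<y) = *-^ _ 0<x 0<y
  *-^-nonNeg {x} {y} {p} 0<p 0<x (inj₂ 0≈y) = begin
    (x * y) ^ p    ≈⟨ ^-cong (trans (*-congˡ (sym 0≈y)) (zeroʳ x)) refl ⟩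
    0# ^ p         ≈⟨ ^-zeroˡ 0<p ⟩
    0#             ≈⟨ sym (zeroʳ _) ⟩
    x ^ p * 0#     ≈⟨ *-congˡ (sym (trans (^-cong (sym 0≈y) refl) (^-zeroˡ 0<p))) ⟩
    x ^ p * y ^ p  ∎
    where open import Relation.Binary.Reasoning.Setoid setoid

  ^-^ℕ : ∀ {x} p n → 0# < x → (x ^ℕ n) ^ p ≈ (x ^ p) ^ℕ n
  ^-^ℕ p zero    0<x = 1^ p
  ^-^ℕ p (suc n) 0<x = trans (*-^ p 0<x (^ℕ-pos n 0<x)) (*-congˡ (^-^ℕ p n 0<x))

  ^-monoʳ-≤ : ∀ {x p q} → 1# ≤ x → p ≤ q → x ^ p ≤ x ^ q
  ^-monoʳ-≤ (inj₁ 1<x) (inj₁ p<q) = inj₁ (^-monoʳ-< 1<x p<q)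
  ^-monoʳ-≤ {p = p} {q} (inj₂ 1≈x) (inj₁ _) = inj₂ (trans (^-cong (sym 1≈x) refl)
    (trans (1^ p) (sym (trans (^-cong (sym 1≈x) refl) (1^ q)))))
  ^-monoʳ-≤ _ (inj₂ p≈q) = inj₂ (^-cong refl p≈q)

  ^-cancelʳ-< : ∀ {x p q} → 1# < x → x ^ p < x ^ q → p < q
  ^-cancelʳ-< {x} {p} {q} 1<x xp<xq with <-or-≥ p q
  ... | inj₁ p<q = p<q
  ... | inj₂ q≤p = ⊥-elim (<⇒≱ xp<xq (^-monoʳ-≤ (inj₁ 1<x) q≤p))

  1≤x⇒x^p≤x : ∀ {x p} → p ≤ 1# → 1# ≤ x → x ^ p ≤ x
  1≤x⇒x^p≤x p≤1 1≤x = ≤-respʳ-≈ (^-one (<-≤-trans 0<1 1≤x)) (^-monoʳ-≤ 1≤x p≤1)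

  -- `1≤x⇒x^p≤x` applied to the reciprocal of x, then multiplied by x^p.
  x≤1⇒x≤x^p : ∀ {x p} → p ≤ 1# → 0# < x → x ≤ 1# → x ≤ x ^ p
  x≤1⇒x≤x^p {x} {p} p≤1 0<x x≤1 = *-cancelˡ-≤ (x ⁻¹) 0<x⁻¹ (begin
    x ⁻¹ * x              ≈⟨ x⁻¹x≈1 ⟩
    1#                    ≈⟨ 1^ p ⟨
    1# ^ p                ≈⟨ ^-cong (sym x⁻¹x≈1) refl ⟩
    (x ⁻¹ * x) ^ p        ≈⟨ *-^ p 0<x⁻¹ 0<x ⟩
    (x ⁻¹) ^ p * x ^ p    ≤⟨ *-mono-≤ (inj₁ 0<x⁻¹) (inj₁ (^-pos p 0<x)) (1≤x⇒x^p≤x p≤1 1≤x⁻¹) ≤-refl ⟩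
    x ⁻¹ * x ^ p          ∎)
    where
    open ≤-Reasoning
    0<x⁻¹ = ⁻¹-pos 0<x
    x⁻¹x≈1 = ⁻¹-inverseˡ (0<⇒≉0 0<x)
    1≤x⁻¹ : 1# ≤ x ⁻¹
    1≤x⁻¹ = ≤-respˡ-≈ x⁻¹x≈1 (≤-respʳ-≈ (*-identityʳ _) (*-monoʳ-≤ (x ⁻¹) (inj₁ 0<x⁻¹) x≤1))

  -- Square roots and logarithms.

  ½ : Carrier
  ½ = 1# / fromℕ 2

  0<2 : 0# < fromℕ 2
  0<2 = fromℕ-pos {2} (s≤s z≤n)

  ½+½≈1 : ½ + ½ ≈ 1#
  ½+½≈1 = trans (solve 1 (λ h → con (+ 1) :* h :+ con (+ 1) :* h := con (+ 2) :* h) refl (fromℕ 2 ⁻¹))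
                (⁻¹-inverseʳ (0<⇒≉0 0<2))

  0<½ : 0# < ½
  0<½ = *-pos 0<1 (⁻¹-pos 0<2)

  √-square : ∀ {x} → 0# < x → √ x * √ x ≈ x
  √-square 0<x = trans (sym (^-+ ½ ½ 0<x)) (trans (^-cong refl ½+½≈1) (^-one 0<x))

  -- Lower bounds > 1 of { b ^ ε ∣ ε > 0 } would be closed under squaring, by
  -- halving ε, which contradicts the existence of their supremum.
  ^-continuous-at-0 : ∀ {b r} → 1# < b → 1# < r → ¬ (∀ ε → 0# < ε → r ≤ b ^ ε)
  ^-continuous-at-0 {b} {r} 1<b 1<r r≤b^ = <⇒≱ ρ<ρρ (upper (ρ * ρ) (inj₁ (<-trans 1<ρ ρ<ρρ) , ρρ≤b^))
    where
    LowerBound : Carrier → Set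
    LowerBound s = 1# ≤ s × (∀ ε → 0# < ε → s ≤ b ^ ε)

    sup = complete LowerBound (r , inj₁ 1<r , r≤b^)
      (b , λ s (_ , s≤b^) → ≤-respʳ-≈ (^-one (<-trans 0<1 1<b)) (s≤b^ 1# 0<1))
    ρ     = proj₁ sup
    upper = proj₁ (proj₂ sup)
    least = proj₂ (proj₂ sup)

    1<ρ : 1# < ρ
    1<ρ = <-≤-trans 1<r (upper r (inj₁ 1<r , r≤b^))

    ρ<ρρ : ρ < ρ * ρ
    ρ<ρρ = <-respˡ-≈ (*-identityʳ ρ) (*-monoʳ-< ρ (<-trans 0<1 1<ρ) 1<ρ)

    ρ≤b^ : ∀ ε → 0# < ε → ρ ≤ b ^ ε
    ρ≤b^ ε 0<ε = least (b ^ ε) (λ s (_ , s≤b^) → s≤b^ ε 0<ε)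

    ρρ≤b^ : ∀ ε → 0# < ε → ρ * ρ ≤ b ^ ε
    ρρ≤b^ ε 0<ε = ≤-respʳ-≈
      (trans (sym (^-+ (ε * ½) (ε * ½) (<-trans 0<1 1<b)))
             (^-cong refl (trans (sym (distribˡ ε ½ ½)) (trans (*-congˡ ½+½≈1) (*-identityʳ ε)))))
      (square-≤ (inj₁ (<-trans 0<1 1<ρ)) (ρ≤b^ (ε * ½) (*-pos 0<ε 0<½)))

  -- The exponent is the supremum of all s with b^s ≤ c. If b^p fell short of c or exceeded it, the
  -- quotient of the larger by the smaller would be above 1, and by `^-continuous-at-0` some b^ε
  -- would lie below that quotient. Then p + ε would still belong to the set, or p - ε would already
  -- bound it.
  logarithm : ∀ {b c} → 1# < c → c < b → ∃ λ p → 0# < p × p < 1# × b ^ p ≈ c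
  logarithm {b} {c} 1<c c<b = p , 0<p , p<1 , b^p≈c
    where
    1<b = <-trans 1<c c<b
    0<b = <-trans 0<1 1<b
    0<c = <-trans 0<1 1<c

    b^<c⇒ : ∀ {s t} → b ^ s ≤ c → c < b ^ t → s < t
    b^<c⇒ b^s≤c c<b^t = ^-cancelʳ-< 1<b (≤-<-trans b^s≤c c<b^t)

    sup = complete (λ s → b ^ s ≤ c) (0# , ≤-respˡ-≈ (sym (^-0# 0<b)) (inj₁ 1<c))
      (1# , λ s b^s≤c → inj₁ (b^<c⇒ b^s≤c (<-respʳ-≈ (sym (^-one 0<b)) c<b)))
    p     = proj₁ sup
    upper = proj₁ (proj₂ sup)
    least = proj₂ (proj₂ sup)

    ratio : ∀ {x y} → 0# < x → x < y → 1# < y * x ⁻¹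
    ratio {x} {y} 0<x x<y = <-respˡ-≈ (⁻¹-inverseˡ (0<⇒≉0 0<x))
      (<-respʳ-≈ (*-comm _ _) (*-monoʳ-< (x ⁻¹) (⁻¹-pos 0<x) x<y))

    cancel : ∀ {x y} → 0# < x → x * (y * x ⁻¹) ≈ y
    cancel {x} {y} 0<x = trans (solve 3 (λ x y z → x :* (y :* z) := (x :* z) :* y) refl x y (x ⁻¹))
      (trans (*-congʳ (⁻¹-inverseʳ (0<⇒≉0 0<x))) (*-identityˡ y))

    b^p≮c : ¬ (b ^ p < c)
    b^p≮c b^p<c = ^-continuous-at-0 1<b (ratio (^-pos p 0<b) b^p<c) λ ε 0<ε → ≮⇒≥ λ b^ε<r →
      <⇒≱ (<-from-diff 0<ε (solve 2 (λ p ε → ε := p :+ ε :- p) refl p ε))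
        (upper (p + ε) (inj₁ (<-respˡ-≈ (sym (^-+ p ε 0<b))
          (<-respʳ-≈ (cancel (^-pos p 0<b)) (*-monoʳ-< (b ^ p) (^-pos p 0<b) b^ε<r)))))

    c≮b^p : ¬ (c < b ^ p)
    c≮b^p c<b^p = ^-continuous-at-0 1<b (ratio 0<c c<b^p) λ ε 0<ε → ≮⇒≥ λ b^ε<r →
      <⇒≱ (<-from-diff {p - ε} 0<ε (solve 2 (λ p ε → ε := p :- (p :- ε)) refl p ε))
        (least (p - ε) (λ s b^s≤c → inj₁ (^-cancelʳ-< 1<b (≤-<-trans b^s≤c (*-cancelˡ-< (b ^ ε) (^-pos ε 0<b)
          (begin-strict
            b ^ ε * c              ≈⟨ *-comm _ _ ⟩
            c * b ^ ε              <⟨ *-monoʳ-< c 0<c b^ε<r ⟩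
            c * (b ^ p * c ⁻¹)     ≈⟨ cancel 0<c ⟩
            b ^ p                  ≈⟨ ^-cong refl (solve 2 (λ p ε → p := ε :+ (p :- ε)) refl p ε) ⟩
            b ^ (ε + (p - ε))      ≈⟨ ^-+ ε (p - ε) 0<b ⟩
            b ^ ε * b ^ (p - ε)    ∎))))))
      where open ≤-Reasoning

    b^p≈c : b ^ p ≈ c
    b^p≈c = ≤-antisym (≮⇒≥ c≮b^p) (≮⇒≥ b^p≮c)

    0<p : 0# < p
    0<p = ^-cancelʳ-< 1<b (<-respˡ-≈ (sym (^-0# 0<b)) (<-respʳ-≈ (sym b^p≈c) 1<c))

    p<1 : p < 1#
    p<1 = ^-cancelʳ-< 1<b (<-respʳ-≈ (sym (^-one 0<b)) (<-respˡ-≈ (sym b^p≈c) c<b))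

-- The quadratic equation of α.

module MetallicMean (ℝ : RealNumbers) (a : ℕ) (1≤a : 1 ℕ.≤ a) where

  open RealNumbers ℝ
  open PContinuedFraction ℝ
  open RealArithmetic ℝ
  open Solver

  -- With γ written as α - a, the equation α² = a α + 1 becomes α γ = 1, and -γ is the conjugate
  -- root.
  A α γ : Carrier
  A = fromℕ a
  α = metallicMean a
  γ = α - A

  private
    s : Carrier
    s = √ (fromℕ (a ℕ.* a ℕ.+ 4))

    ss≈AA+4 : s * s ≈ A * A + fromℕ 4
    ss≈AA+4 = trans (√-square (fromℕ-pos (ℕ.≤-trans (s≤s z≤n) (ℕ.m≤n+m 4 (a ℕ.* a)))))
      (trans (fromℕ-+ (a ℕ.* a) 4) (+-congʳ (fromℕ-* a a)))

    2α≈A+s : fromℕ 2 * α ≈ A + s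
    2α≈A+s = trans (solve 3 (λ t i x → t :* (x :* i) := (t :* i) :* x) refl (fromℕ 2) (fromℕ 2 ⁻¹) (A + s))
      (trans (*-congʳ (⁻¹-inverseʳ (0<⇒≉0 0<2))) (*-identityˡ _))

    A<s : A < s
    A<s = square-cancel-< (inj₁ (^-pos _ (fromℕ-pos (ℕ.≤-trans (s≤s z≤n) (ℕ.m≤n+m 4 (a ℕ.* a))))))
      (<-respʳ-≈ (sym ss≈AA+4) (<-from-diff (fromℕ-pos {4} (s≤s z≤n))
        (solve 1 (λ x → con (+ 4) := x :* x :+ con (+ 4) :- x :* x) refl A)))

  A<α : A < α
  A<α = *-cancelˡ-< (fromℕ 2) 0<2 (<-respʳ-≈ (sym 2α≈A+s)
    (<-from-diff (x<y⇒0<y-x A<s) (solve 2 (λ x s → s :- x := x :+ s :- con (+ 2) :* x) refl A s)))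

  αα≈Aα+1 : α * α ≈ A * α + 1#
  αα≈Aα+1 = *-cancelˡ-≈ (fromℕ 4) (fromℕ-pos {4} (s≤s z≤n)) (begin
    fromℕ 4 * (α * α)
      ≈⟨ solve 1 (λ x → con (+ 4) :* (x :* x) := (con (+ 2) :* x) :* (con (+ 2) :* x)) refl α ⟩
    (fromℕ 2 * α) * (fromℕ 2 * α)
      ≈⟨ *-cong 2α≈A+s 2α≈A+s ⟩
    (A + s) * (A + s)
      ≈⟨ solve 2 (λ x s → (x :+ s) :* (x :+ s) := s :* s :+ con (+ 2) :* x :* s :+ x :* x) refl A s ⟩
    s * s + fromℕ 2 * A * s + A * A
      ≈⟨ +-congʳ (+-congʳ ss≈AA+4) ⟩
    A * A + fromℕ 4 + fromℕ 2 * A * s + A * A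
      ≈⟨ solve 2 (λ x s → x :* x :+ con (+ 4) :+ con (+ 2) :* x :* s :+ x :* x
                       := con (+ 2) :* x :* (x :+ s) :+ con (+ 4)) refl A s ⟩
    fromℕ 2 * A * (A + s) + fromℕ 4
      ≈⟨ +-congʳ (*-congˡ (sym 2α≈A+s)) ⟩
    fromℕ 2 * A * (fromℕ 2 * α) + fromℕ 4
      ≈⟨ solve 2 (λ x y → con (+ 2) :* x :* (con (+ 2) :* y) :+ con (+ 4)
                       := con (+ 4) :* (x :* y :+ con (+ 1))) refl A α ⟩
    fromℕ 4 * (A * α + 1#) ∎)
    where open import Relation.Binary.Reasoning.Setoid setoid

  1≤A : 1# ≤ A
  1≤A = ≤-respˡ-≈ fromℕ-1 (fromℕ-mono-≤ 1≤a)

  1<α : 1# < α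
  1<α = ≤-<-trans 1≤A A<α

  0<α : 0# < α
  0<α = <-trans 0<1 1<α

  0<γ : 0# < γ
  0<γ = x<y⇒0<y-x A<α

  αγ≈1 : α * γ ≈ 1#
  αγ≈1 = begin
    α * (α - A)          ≈⟨ solve 2 (λ x y → x :* (x :- y) := x :* x :- y :* x) refl α A ⟩
    α * α - A * α        ≈⟨ +-congʳ αα≈Aα+1 ⟩
    A * α + 1# - A * α   ≈⟨ solve 1 (λ x → x :+ con (+ 1) :- x := con (+ 1)) refl (A * α) ⟩
    1#                   ∎
    where open import Relation.Binary.Reasoning.Setoid setoid

  γ<1 : γ < 1#
  γ<1 = *-cancelˡ-< α 0<α (<-respˡ-≈ (sym αγ≈1) (<-respʳ-≈ (sym (*-identityʳ α)) 1<α))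

  -- For a = 1 the number α itself is below 2, so growth by a factor 2 is counted over two indices.
  2≤αα : fromℕ 2 ≤ α * α
  2≤αα = ≤-respʳ-≈ (sym αα≈Aα+1) (≤-from-diff
    (+-nonNeg (x≤y⇒0≤y-x 1≤A) (*-nonNeg (≤-trans (inj₁ 0<1) 1≤A) (x≤y⇒0≤y-x (inj₁ 1<α))))
    (solve 2 (λ x y → (x :- con (+ 1)) :+ x :* (y :- con (+ 1)) := x :* y :+ con (+ 1) :- con (+ 2)) refl A α))

  -- Convergents and Binet's formula.

  -- For constant partial quotients p_n = c (2 + n) and q_n = c (1 + n).
  c : ℕ → ℕ
  c = numerators (const a)

  denominators≡c : ∀ k → denominators (const a) (suc k) ≡ c k
  denominators≡c zero          = ≡.refl
  denominators≡c (suc zero)    = ≡.cong (ℕ._+ 1) (ℕ.*-zeroʳ a)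
  denominators≡c (suc (suc k)) =
    ≡.cong₂ (λ x y → a ℕ.* x ℕ.+ y) (denominators≡c (suc k)) (denominators≡c k)

  1≤c : ∀ k → 1 ℕ.≤ c (suc k)
  1≤c zero    = s≤s z≤n
  1≤c (suc k) = ℕ.≤-trans (ℕ.*-mono-≤ 1≤a (1≤c k)) (ℕ.m≤m+n _ (c k))

  C : ℕ → Carrier
  C k = fromℕ (c k)

  1≤C : ∀ {k} → 1 ℕ.≤ k → 1# ≤ C k
  1≤C {suc k} _ = ≤-respˡ-≈ fromℕ-1 (fromℕ-mono-≤ (1≤c k))

  C-rec : ∀ k → C (suc (suc k)) ≈ A * C (suc k) + C k
  C-rec k = trans (fromℕ-+ (a ℕ.* c (suc k)) (c k)) (+-congʳ (fromℕ-* a (c (suc k))))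

  -- The recurrence multiplies C (k+1) - α C k by -γ, because a - α = -γ and α γ = 1. This gives p_n
  -- - q_n α = (-γ)^(n+1), the second coordinate of the lattice point of a convergent.
  C-suc : ∀ k → C (suc k) ≈ α * C k + (- γ) ^ℕ k
  C-suc zero    = solve 1 (λ x → con (+ 1) :+ con (+ 0) := x :* con (+ 0) :+ con (+ 1)) refl α
  C-suc (suc k) = begin
    C (suc (suc k))                        ≈⟨ C-rec k ⟩
    A * C (suc k) + C k
      ≈⟨ solve 4 (λ x y r s → x :* r :+ s := y :* r :+ s :+ (:- (y :- x)) :* r) refl A α (C (suc k)) (C k) ⟩
    α * C (suc k) + C k + (- γ) * C (suc k)     ≈⟨ +-congˡ (*-congˡ (C-suc k)) ⟩
    α * C (suc k) + C k + (- γ) * (α * C k + (- γ) ^ℕ k)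
      ≈⟨ solve 5 (λ y g r s t → y :* r :+ s :+ (:- g) :* (y :* s :+ t)
               := y :* r :+ (con (+ 1) :- y :* g) :* s :+ (:- g) :* t) refl α γ (C (suc k)) (C k) ((- γ) ^ℕ k) ⟩
    α * C (suc k) + (1# - α * γ) * C k + (- γ) ^ℕ suc k
      ≈⟨ +-congʳ (+-congˡ (*-congʳ (+-congˡ (-‿cong αγ≈1)))) ⟩
    α * C (suc k) + (1# - 1#) * C k + (- γ) ^ℕ suc k
      ≈⟨ solve 3 (λ x y z → x :+ (con (+ 1) :- con (+ 1)) :* y :+ z := x :+ z) refl _ (C k) _ ⟩
    α * C (suc k) + (- γ) ^ℕ suc k              ∎
    where open import Relation.Binary.Reasoning.Setoid setoid

  -- The factor α + γ is the difference of the two roots, √(a² + 4).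
  binet : ∀ k → (α + γ) * C k + (- γ) ^ℕ k ≈ α ^ℕ k
  binet zero    = solve 1 (λ x → x :* con (+ 0) :+ con (+ 1) := con (+ 1)) refl (α + γ)
  binet (suc k) = begin
    (α + γ) * C (suc k) + (- γ) ^ℕ suc k     ≈⟨ +-congʳ (*-congˡ (C-suc k)) ⟩
    (α + γ) * (α * C k + (- γ) ^ℕ k) + (- γ) * (- γ) ^ℕ k
      ≈⟨ solve 4 (λ y g s t → (y :+ g) :* (y :* s :+ t) :+ (:- g) :* t
               := y :* ((y :+ g) :* s :+ t)) refl α γ (C k) ((- γ) ^ℕ k) ⟩
    α * ((α + γ) * C k + (- γ) ^ℕ k)         ≈⟨ *-congˡ (binet k) ⟩
    α ^ℕ suc k                               ∎
    where open import Relation.Binary.Reasoning.Setoid setoid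

  -- Lattice points close to the x-axis, by descent.

  scale-< : ∀ {x y z} → 1# ≤ z → 0# < y → z * x < y → x < y
  scale-< {x} {y} {z} 1≤z 0<y zx<y with <-or-≥ x y
  ... | inj₁ x<y = x<y
  ... | inj₂ y≤x = ⊥-elim (<⇒≱ zx<y
    (≤-respˡ-≈ (*-identityˡ y) (*-mono-≤ (≤-trans (inj₁ 0<1) 1≤z) (inj₁ 0<y) 1≤z y≤x)))

  Small : Carrier → Set
  Small x = - 1# < x × x < 1#

  Small-resp : ∀ {x y} → x ≈ y → Small x → Small y
  Small-resp x≈y (l , r) = <-respʳ-≈ x≈y l , <-respˡ-≈ x≈y r

  Small-neg : ∀ {x} → Small x → Small (- x)
  Small-neg {x} (l , r) =
    <-from-diff (x<y⇒0<y-x r) (solve 1 (λ x → con (+ 1) :- x := :- x :- (:- con (+ 1))) refl x) ,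
    <-from-diff (x<y⇒0<y-x l) (solve 1 (λ x → x :- (:- con (+ 1)) := con (+ 1) :- (:- x)) refl x)

  Small-unscale : ∀ {x z} → 1# ≤ z → Small (z * x) → Small x
  Small-unscale {x} {z} 1≤z small =
    <-from-diff (x<y⇒0<y-x -x<1) (solve 1 (λ x → con (+ 1) :- (:- x) := x :- (:- con (+ 1))) refl x) ,
    scale-< 1≤z 0<1 (proj₂ small)
    where
    -x<1 : - x < 1#
    -x<1 = scale-< 1≤z 0<1 (<-respˡ-≈ (solve 2 (λ x z → :- (z :* x) := z :* (:- x)) refl x z) (proj₂ (Small-neg small)))

  small-integer : ∀ i → Small (fromℤ i) → i ≡ + 0
  small-integer i (-1<i , i<1) = ℤ.≤-antisym
    (ℤ.i<j⇒i≤pred[j] (fromℤ-cancel-< {i} {+ 1} (<-respʳ-≈ (sym fromℕ-1) i<1)))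
    (ℤ.i<j⇒suc[i]≤j (fromℤ-cancel-< { -[1+ 0 ]} {i} (<-respˡ-≈ (-‿cong (sym fromℕ-1)) -1<i)))

  linearForm : ℤ → ℤ → Carrier
  linearForm u v = fromℤ u + fromℤ v * - α

  -- Both coordinates are bounded because undoing one descent step sends (U , V) to (a U + V , U):
  -- the old bound on U becomes the bound on V, and the two together reproduce the recurrence of
  -- `c`.
  Dominates : ℕ → ℤ → ℤ → Set
  Dominates n u v = ∃₂ λ U V → c (suc n) ℕ.≤ V × c (suc (suc n)) ℕ.≤ U × u ≡ + U × v ≡ + V

  -- From u - v α > -1 and v ≥ 1 follows u > α - 1 > a - 1, hence u ≥ a.
  dominates₀ : ∀ u k → Small (linearForm u (+ suc k)) → Dominates 0 u (+ suc k)
  dominates₀ u k (-1<y , _) = conclude a≤u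
    where
    a-1<u : fromℤ (+ a ℤ.- + 1) < fromℤ u
    a-1<u = <-from-diff
      (+-pos-nonNeg (+-pos (x<y⇒0<y-x -1<y) (x<y⇒0<y-x A<α)) (*-nonNeg (fromℕ-nonNeg k) (inj₁ 0<α)))
      (trans
        (solve 4 (λ u k x y → (u :+ (con (+ 1) :+ k) :* (:- y)) :- (:- con (+ 1)) :+ (y :- x) :+ k :* y
                           := u :- (x :- (con (+ 1) :+ con (+ 0)))) refl (fromℤ u) (fromℕ k) A α)
        (+-congˡ (-‿cong (sym (fromℤ-+ (+ a) (ℤ.- + 1))))))

    a≤u : + a ℤ.≤ u
    a≤u = ≡.subst (ℤ._≤ u) (ℤ.suc-pred (+ a))
      (≡.subst (λ i → ℤ.suc i ℤ.≤ u) (ℤ.+-comm (+ a) (ℤ.- + 1)) (ℤ.i<j⇒suc[i]≤j (fromℤ-cancel-< {+ a ℤ.- + 1} {u} a-1<u)))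

    conclude : ∀ {u} → + a ℤ.≤ u → Dominates 0 u (+ suc k)
    conclude (ℤ.+≤+ {n = U} a≤U) = U , suc k , s≤s z≤n ,
      ≡.subst (ℕ._≤ U) (≡.sym (≡.trans (ℕ.+-identityʳ _) (ℕ.*-identityʳ a))) a≤U , ≡.refl , ≡.refl

  -- Multiplication by α maps the lattice to itself, acting by (u , v) ↦ (- v , a v - u).
  linearForm-* : ∀ u v → linearForm (ℤ.- v) (+ a ℤ.* v ℤ.- u) ≈ α * linearForm u v
  linearForm-* u v = begin
    fromℤ (ℤ.- v) + fromℤ (+ a ℤ.* v ℤ.- u) * - α
      ≈⟨ +-cong (fromℤ-neg v) (*-congʳ (trans (fromℤ-+ (+ a ℤ.* v) (ℤ.- u)) (+-cong (fromℤ-* (+ a) v) (fromℤ-neg u)))) ⟩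
    - fromℤ v + (A * fromℤ v - fromℤ u) * - α
      ≈⟨ solve 4 (λ u v x y → :- v :+ (x :* v :- u) :* (:- y) := u :* y :- (x :* y :+ con (+ 1)) :* v) refl (fromℤ u) (fromℤ v) A α ⟩
    fromℤ u * α - (A * α + 1#) * fromℤ v
      ≈⟨ +-congˡ (-‿cong (*-congʳ (sym αα≈Aα+1))) ⟩
    fromℤ u * α - α * α * fromℤ v
      ≈⟨ solve 3 (λ u v y → u :* y :- y :* y :* v := y :* (u :+ v :* (:- y))) refl (fromℤ u) (fromℤ v) α ⟩
    α * linearForm u v ∎
    where open import Relation.Binary.Reasoning.Setoid setoid

  linearForm-neg : ∀ u v → linearForm (ℤ.- u) (ℤ.- v) ≈ - linearForm u v
  linearForm-neg u v = trans (+-cong (fromℤ-neg u) (*-congʳ (fromℤ-neg v)))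
    (solve 3 (λ u v y → :- u :+ (:- v) :* (:- y) := :- (u :+ v :* (:- y))) refl (fromℤ u) (fromℤ v) α)

  linearForm≈0 : ∀ {u v} → v ≡ + 0 → linearForm u v ≈ fromℤ u
  linearForm≈0 {u} ≡.refl = solve 2 (λ u y → u :+ con (+ 0) :* (:- y) := u) refl (fromℤ u) α

  -- Descent on n: multiplication by α absorbs one factor of α^n and replaces (u , v) by (-v , a v -
  -- u). Each step exchanges the roles of (u , v) and its negative, so the conclusion is only up to
  -- sign.
  dominates : ∀ n u v → v ≢ + 0 → Small (α ^ℕ n * linearForm u v) →
              Dominates n u v ⊎ Dominates n (ℤ.- u) (ℤ.- v)
  dominates zero u (+ zero)  v≢0 small = ⊥-elim (v≢0 ≡.refl)
  dominates zero u (+ suc k) v≢0 small = inj₁ (dominates₀ u k (Small-resp (*-identityˡ _) small))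
  dominates zero u -[1+ k ]  v≢0 small = inj₂ (dominates₀ (ℤ.- u) k
    (Small-resp (trans (-‿cong (*-identityˡ _)) (sym (linearForm-neg u -[1+ k ]))) (Small-neg small)))
  dominates (suc n) u v v≢0 small = conclude (dominates n u′ v′ v′≢0 small′)
    where
    u′ = ℤ.- v
    v′ = + a ℤ.* v ℤ.- u

    small′ : Small (α ^ℕ n * linearForm u′ v′)
    small′ = Small-resp (trans (solve 3 (λ x y z → x :* y :* z := y :* (x :* z)) refl α (α ^ℕ n) (linearForm u v))
      (*-congˡ (sym (linearForm-* u v)))) small

    -- Were `v′` zero, the form would equal the integer -v and be smaller than 1 in absolute value,
    -- forcing v = 0.
    v′≢0 : v′ ≢ + 0
    v′≢0 v′≡0 = v≢0 (ℤ.neg-injective {v} {+ 0} (small-integer u′ u′-small))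
      where u′-small = Small-resp (linearForm≈0 {u′} {v′} v′≡0) (Small-unscale (1≤^ℕ n (inj₁ 1<α)) small′)

    open ℤSolver.+-*-Solver using ()
      renaming (solve to solveℤ; _:=_ to _:≡_; _:*_ to _:⊛_; _:+_ to _:⊕_; _:-_ to _:⊖_; :-_ to ⊝_)

    u-from : ∀ {U V} → u′ ≡ + U → v′ ≡ + V → ℤ.- u ≡ + (a ℕ.* U ℕ.+ V)
    u-from {U} {V} u′≡U v′≡V = begin
      ℤ.- u                                ≡⟨ solveℤ 3 (λ u v x → ⊝ u :≡ x :⊛ (⊝ v) :⊕ (x :⊛ v :⊖ u)) ≡.refl u v (+ a) ⟩
      + a ℤ.* u′ ℤ.+ v′                    ≡⟨ ≡.cong₂ (λ x y → + a ℤ.* x ℤ.+ y) u′≡U v′≡V ⟩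
      + a ℤ.* + U ℤ.+ + V                  ≡⟨ ≡.cong (ℤ._+ + V) (≡.sym (ℤ.pos-* a U)) ⟩
      + (a ℕ.* U ℕ.+ V)                    ∎
      where open ≡.≡-Reasoning

    u-from-neg : ∀ {U V} → ℤ.- u′ ≡ + U → ℤ.- v′ ≡ + V → u ≡ + (a ℕ.* U ℕ.+ V)
    u-from-neg {U} {V} u′≡U v′≡V = begin
      u                                    ≡⟨ solveℤ 3 (λ u v x → u :≡ x :⊛ (⊝ (⊝ v)) :⊕ (⊝ (x :⊛ v :⊖ u))) ≡.refl u v (+ a) ⟩
      + a ℤ.* (ℤ.- u′) ℤ.+ (ℤ.- v′)        ≡⟨ ≡.cong₂ (λ x y → + a ℤ.* x ℤ.+ y) u′≡U v′≡V ⟩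
      + a ℤ.* + U ℤ.+ + V                  ≡⟨ ≡.cong (ℤ._+ + V) (≡.sym (ℤ.pos-* a U)) ⟩
      + (a ℕ.* U ℕ.+ V)                    ∎
      where open ≡.≡-Reasoning

    grow : ∀ {U V} → c (suc n) ℕ.≤ V → c (suc (suc n)) ℕ.≤ U → c (suc (suc (suc n))) ℕ.≤ a ℕ.* U ℕ.+ V
    grow V≥ U≥ = ℕ.+-mono-≤ (ℕ.*-monoʳ-≤ a U≥) V≥

    conclude : Dominates n u′ v′ ⊎ Dominates n (ℤ.- u′) (ℤ.- v′) → Dominates (suc n) u v ⊎ Dominates (suc n) (ℤ.- u) (ℤ.- v)
    conclude (inj₁ (U , V , V≥ , U≥ , u′≡U , v′≡V)) =
      inj₂ (a ℕ.* U ℕ.+ V , U , U≥ , grow V≥ U≥ , u-from u′≡U v′≡V , u′≡U)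
    conclude (inj₂ (U , V , V≥ , U≥ , u′≡U , v′≡V)) =
      inj₁ (a ℕ.* U ℕ.+ V , U , U≥ , grow V≥ U≥ , u-from-neg u′≡U v′≡V , ≡.trans (≡.sym (ℤ.neg-involutive v)) u′≡U)

  -- Two-sided size estimates for the denominators.

  ^ℕ-inverse : ∀ {x y} n → x * y ≈ 1# → x ^ℕ n * y ^ℕ n ≈ 1#
  ^ℕ-inverse {x} {y} n xy≈1 = trans (sym (*-^ℕ x y n)) (trans (^ℕ-congˡ n xy≈1) (1^ℕ n))

  neg-^ℕ : ∀ x n → (- x) ^ℕ n ≈ x ^ℕ n ⊎ (- x) ^ℕ n ≈ - (x ^ℕ n)
  neg-^ℕ x zero = inj₁ refl
  neg-^ℕ x (suc n) with neg-^ℕ x n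
  ... | inj₁ eq = inj₂ (trans (*-congˡ eq) (solve 2 (λ x y → :- x :* y := :- (x :* y)) refl x (x ^ℕ n)))
  ... | inj₂ eq = inj₁ (trans (*-congˡ eq) (solve 2 (λ x y → :- x :* (:- y) := x :* y) refl x (x ^ℕ n)))

  neg-^ℕ-bounds : ∀ {x} n → 0# ≤ x → - (x ^ℕ n) ≤ (- x) ^ℕ n × (- x) ^ℕ n ≤ x ^ℕ n
  neg-^ℕ-bounds {x} n 0≤x = bounds (neg-^ℕ x n)
    where
    -x^n≤x^n : - (x ^ℕ n) ≤ x ^ℕ n
    -x^n≤x^n = ≤-from-diff (+-nonNeg (^ℕ-nonNeg n 0≤x) (^ℕ-nonNeg n 0≤x))
      (solve 1 (λ y → y :+ y := y :- (:- y)) refl (x ^ℕ n))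

    bounds : (- x) ^ℕ n ≈ x ^ℕ n ⊎ (- x) ^ℕ n ≈ - (x ^ℕ n) → - (x ^ℕ n) ≤ (- x) ^ℕ n × (- x) ^ℕ n ≤ x ^ℕ n
    bounds (inj₁ eq) = ≤-respʳ-≈ (sym eq) -x^n≤x^n , inj₂ eq
    bounds (inj₂ eq) = inj₂ (sym eq) , ≤-respˡ-≈ (sym eq) -x^n≤x^n

  δ : Carrier
  δ = α + γ

  0<δ : 0# < δ
  0<δ = +-pos 0<α 0<γ

  -- Binet's formula with the alternating term replaced by its worst sign, so that the parity of k
  -- disappears from the later estimates.
  δC-upper : ∀ k → δ * C k ≤ α ^ℕ k + γ ^ℕ k
  δC-upper k = ≤-from-diff (x≤y⇒0≤y-x (proj₁ (neg-^ℕ-bounds k (inj₁ 0<γ))))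
    (trans (solve 3 (λ d g e → e :- (:- g) := d :+ e :+ g :- d) refl (δ * C k) (γ ^ℕ k) ((- γ) ^ℕ k))
      (+-congʳ (+-congʳ (binet k))))

  δC-lower : ∀ k → α ^ℕ k - γ ^ℕ k ≤ δ * C k
  δC-lower k = ≤-from-diff (x≤y⇒0≤y-x (proj₂ (neg-^ℕ-bounds k (inj₁ 0<γ))))
    (trans (solve 3 (λ d g e → g :- e := d :- ((d :+ e) :- g)) refl (δ * C k) (γ ^ℕ k) ((- γ) ^ℕ k))
      (+-congˡ (-‿cong (+-congʳ (binet k)))))

  αγ^ : ∀ k → α ^ℕ k * γ ^ℕ k ≈ 1#
  αγ^ k = ^ℕ-inverse k αγ≈1

  α^+γ^ : ∀ k → α ^ℕ k + γ ^ℕ k ≈ α ^ℕ k * (1# + γ ^ℕ k * γ ^ℕ k)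
  α^+γ^ k = sym (trans (solve 2 (λ x y → x :* (con (+ 1) :+ y :* y) := x :+ (x :* y) :* y) refl (α ^ℕ k) (γ ^ℕ k))
    (+-congˡ (trans (*-congʳ (αγ^ k)) (*-identityˡ _))))

  α^-γ^ : ∀ k → α ^ℕ k - γ ^ℕ k ≈ α ^ℕ k * (1# - γ ^ℕ k * γ ^ℕ k)
  α^-γ^ k = sym (trans (solve 2 (λ x y → x :* (con (+ 1) :- y :* y) := x :- (x :* y) :* y) refl (α ^ℕ k) (γ ^ℕ k))
    (+-congˡ (-‿cong (trans (*-congʳ (αγ^ k)) (*-identityˡ _)))))

  -- Comparison of the convergents with one another.

  module Extremal
    (N : ℕ) (36≤N : 36 ℕ.≤ N) (growth : fromℕ 8 * (fromℕ N * fromℕ N) ≤ α ^ℕ N)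
    {p : Carrier} (0<p : 0# < p) (p<1 : p < 1#) (f[α^N]≈2 : (α ^ℕ N) ^ p ≈ fromℕ 2) where

    f : Carrier → Carrier
    f x = x ^ p

    -- `b` is the height |y| of the intended minimiser, and its p-th power `h ^ℕ N` is 1/2.
    g h b : Carrier
    g = f α
    h = f γ
    b = γ ^ℕ N

    gh≈1 : g * h ≈ 1#
    gh≈1 = trans (sym (*-^ p 0<α 0<γ)) (trans (^-cong αγ≈1 refl) (1^ p))

    0<g : 0# < g
    0<g = ^-pos p 0<α

    0<h : 0# < h
    0<h = ^-pos p 0<γ

    1<g : 1# < g
    1<g = <-respˡ-≈ (1^ p) (^-mono-< 0<p (inj₁ 0<1) 1<α)

    h<1 : h < 1#
    h<1 = <-respʳ-≈ (1^ p) (^-mono-< 0<p (inj₁ 0<γ) γ<1)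

    g^N≈2 : g ^ℕ N ≈ fromℕ 2
    g^N≈2 = trans (sym (^-^ℕ p N 0<α)) f[α^N]≈2

    gh^ : ∀ k → g ^ℕ k * h ^ℕ k ≈ 1#
    gh^ k = ^ℕ-inverse k gh≈1

    2h^N≈1 : fromℕ 2 * h ^ℕ N ≈ 1#
    2h^N≈1 = trans (*-congʳ (sym g^N≈2)) (gh^ N)

    0<b : 0# < b
    0<b = ^ℕ-pos N 0<γ

    b≤1 : b ≤ 1#
    b≤1 = ^ℕ≤1 N (inj₁ 0<γ) (inj₁ γ<1)

    -- By Bernoulli's inequality 8 (9/8)⁹ ≥ 17, whereas 8 g³⁶ ≤ 8 g ^ N = 16.
    8g⁴<9 : fromℕ 8 * g ^ℕ 4 < fromℕ 9
    8g⁴<9 = ≰⇒> λ 9≤8g⁴ → <⇒≱ {fromℕ 8 * g ^ℕ N} {fromℕ 17}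
      (<-from-diff 0<1 (trans (solve 0 (con (+ 1) := con (+ 17) :- con (+ 8) :* con (+ 2)) refl)
        (+-congˡ (-‿cong (*-congˡ (sym g^N≈2))))))
      (begin
        fromℕ 17                                  ≤⟨ ≤-from-diff (*-nonNeg (fromℕ-nonNeg 9) (x≤y⇒0≤y-x 9≤8g⁴))
          (solve 1 (λ x → con (+ 9) :* (con (+ 8) :* x :- con (+ 9)) := con (+ 8) :* (con (+ 1) :- con (+ 9) :* (con (+ 1) :- x)) :- con (+ 17)) refl (g ^ℕ 4)) ⟩
        fromℕ 8 * (1# - fromℕ 9 * (1# - g ^ℕ 4))  ≤⟨ *-monoʳ-≤ (fromℕ 8) (fromℕ-nonNeg 8) (bernoulli 9 (^ℕ-nonNeg 4 (inj₁ 0<g))) ⟩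
        fromℕ 8 * (g ^ℕ 4) ^ℕ 9                   ≈⟨ *-congˡ (^ℕ-* g 4 9) ⟩
        fromℕ 8 * g ^ℕ 36                         ≤⟨ *-monoʳ-≤ (fromℕ 8) (fromℕ-nonNeg 8) (^ℕ-monoʳ-≤ (inj₁ 1<g) 36≤N) ⟩
        fromℕ 8 * g ^ℕ N                          ∎)
      where open ≤-Reasoning

    f2≤g² : f (fromℕ 2) ≤ g * g
    f2≤g² = ≤-respʳ-≈ (*-^ p 0<α 0<α) (^-mono-≤ 0<p (inj₁ 0<2) 2≤αα)

    η : Carrier
    η = 1# - h

    -- The error is weighed against the drop here. Bernoulli gives 1/2 = h^N ≥ 1 - N η, so η ≥
    -- 1/(2N), while `growth` gives b ≤ 1/(8N²).
    2b≤ηη : fromℕ 2 * b ≤ η * η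
    2b≤ηη = *-cancelˡ-≤ (fromℕ 4 * (fromℕ N * fromℕ N)) 0<4NN (begin
      fromℕ 4 * (fromℕ N * fromℕ N) * (fromℕ 2 * b)
        ≈⟨ solve 2 (λ n b → con (+ 4) :* (n :* n) :* (con (+ 2) :* b) := b :* (con (+ 8) :* (n :* n))) refl (fromℕ N) b ⟩
      b * (fromℕ 8 * (fromℕ N * fromℕ N))  ≤⟨ *-monoʳ-≤ b (inj₁ 0<b) growth ⟩
      b * α ^ℕ N                           ≈⟨ trans (*-comm _ _) (αγ^ N) ⟩
      1#                                   ≈⟨ *-identityˡ 1# ⟨
      1# * 1#                              ≤⟨ square-≤ (inj₁ 0<1) 1≤2Nη ⟩
      (fromℕ 2 * fromℕ N * η) * (fromℕ 2 * fromℕ N * η)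
        ≈⟨ solve 2 (λ n e → (con (+ 2) :* n :* e) :* (con (+ 2) :* n :* e) := con (+ 4) :* (n :* n) :* (e :* e)) refl (fromℕ N) η ⟩
      fromℕ 4 * (fromℕ N * fromℕ N) * (η * η) ∎)
      where
      open ≤-Reasoning
      0<N : 0# < fromℕ N
      0<N = fromℕ-pos (ℕ.≤-trans (s≤s z≤n) 36≤N)
      0<4NN : 0# < fromℕ 4 * (fromℕ N * fromℕ N)
      0<4NN = *-pos (fromℕ-pos {4} (s≤s z≤n)) (*-pos 0<N 0<N)
      1≤2Nη : 1# ≤ fromℕ 2 * fromℕ N * η
      1≤2Nη = ≤-from-diff (x≤y⇒0≤y-x (*-monoʳ-≤ (fromℕ 2) (inj₁ 0<2) (bernoulli N (inj₁ 0<h))))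
        (trans (+-congʳ 2h^N≈1)
          (solve 2 (λ n e → con (+ 1) :- con (+ 2) :* (con (+ 1) :- n :* e) := con (+ 2) :* n :* e :- con (+ 1)) refl (fromℕ N) η))

    module _ (J : ℕ) (1≤J : 1 ℕ.≤ J) where
      private
        w e : Carrier
        w = h ^ℕ J
        e = γ ^ℕ J
        0<w : 0# < w
        0<w = ^ℕ-pos J 0<h
        w≤1 : w ≤ 1#
        w≤1 = ^ℕ≤1 J (inj₁ 0<h) (inj₁ h<1)
        0<e : 0# < e
        0<e = ^ℕ-pos J 0<γ
        e≤γ : e ≤ γ
        e≤γ = ≤-respʳ-≈ (*-identityʳ γ) (^ℕ-antiʳ-≤ (inj₁ 0<γ) (inj₁ γ<1) 1≤J)
        ee<1 : e * e < 1#
        ee<1 = <-respʳ-≈ (*-identityˡ 1#) (square-< (inj₁ 0<e) (≤-<-trans e≤γ γ<1))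
        0<1-ee : 0# < 1# - e * e
        0<1-ee = x<y⇒0<y-x ee<1
        0≤4w[1-w] : 0# ≤ fromℕ 4 * (w * (1# - w))
        0≤4w[1-w] = *-nonNeg (fromℕ-nonNeg 4) (*-nonNeg (inj₁ 0<w) (x≤y⇒0≤y-x w≤1))

      -- Both correction factors are replaced by constants: f (1 + b²) ≤ f 2 ≤ g², and f (1 - e²) ≥
      -- 1/g² because α² (1 - e²) ≥ α² - 1 ≥ 1. It remains to see that 4 w (1 - w) g⁴ < 1. Here w² ≥
      -- h^N = 1/2, hence w ≥ 2/3 and 4 w (1 - w) ≤ 8/9, which matches g⁴ < 9/8.
      core-small : 2 ℕ.* J ℕ.≤ N →
        fromℕ 4 * (w * (1# - w)) * f (1# + b * b) < f (1# - e * e)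
      core-small 2J≤N = *-cancelˡ-< (g * g) (*-pos 0<g 0<g) (begin-strict
        g * g * (W * f (1# + b * b))  ≤⟨ *-monoʳ-≤ (g * g) (inj₁ (*-pos 0<g 0<g)) (*-monoʳ-≤ W 0≤4w[1-w] (≤-trans f1+bb≤f2 f2≤g²)) ⟩
        g * g * (W * (g * g))         ≈⟨ solve 2 (λ g W → g :* g :* (W :* (g :* g)) := W :* g :^ 4) refl g W ⟩
        W * g ^ℕ 4                    <⟨ Wg⁴<1 ⟩
        1#                            ≈⟨ 1^ p ⟨
        f 1#                          ≤⟨ ^-mono-≤ 0<p (inj₁ 0<1) 1≤αα[1-ee] ⟩
        f (α * α * (1# - e * e))      ≈⟨ trans (*-^ p (*-pos 0<α 0<α) 0<1-ee) (*-congʳ (*-^ p 0<α 0<α)) ⟩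
        g * g * f (1# - e * e)        ∎)
        where
        open ≤-Reasoning
        W = fromℕ 4 * (w * (1# - w))

        f1+bb≤f2 : f (1# + b * b) ≤ f (fromℕ 2)
        f1+bb≤f2 = ^-mono-≤ 0<p (inj₁ (+-pos 0<1 (*-pos 0<b 0<b)))
          (+-mono-≤ ≤-refl (≤-trans (≤-respʳ-≈ (*-identityˡ 1#) (square-≤ (inj₁ 0<b) b≤1)) (inj₂ (sym fromℕ-1))))

        1≤αα[1-ee] : 1# ≤ α * α * (1# - e * e)
        1≤αα[1-ee] = begin
          1#                         ≤⟨ ≤-from-diff (x≤y⇒0≤y-x 2≤αα)
                                         (solve 1 (λ x → x :- con (+ 2) := x :- con (+ 1) :* con (+ 1) :- con (+ 1)) refl (α * α)) ⟩
          α * α - 1# * 1#            ≈⟨ +-congˡ (-‿cong (*-cong (sym αγ≈1) (sym αγ≈1))) ⟩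
          α * α - α * γ * (α * γ)    ≤⟨ ≤-from-diff (*-nonNeg (inj₁ (*-pos 0<α 0<α)) (x≤y⇒0≤y-x (square-≤ (inj₁ 0<e) e≤γ)))
            (solve 3 (λ x y e → x :* x :* (y :* y :- e :* e) := x :* x :* (con (+ 1) :- e :* e) :- (x :* x :- x :* y :* (x :* y))) refl α γ e) ⟩
          α * α * (1# - e * e)       ∎

        1≤2ww : 1# ≤ fromℕ 2 * (w * w)
        1≤2ww = begin
          1#                     ≈⟨ 2h^N≈1 ⟨
          fromℕ 2 * h ^ℕ N       ≤⟨ *-monoʳ-≤ (fromℕ 2) (inj₁ 0<2) (^ℕ-antiʳ-≤ (inj₁ 0<h) (inj₁ h<1) 2J≤N) ⟩
          fromℕ 2 * h ^ℕ (2 ℕ.* J)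
            ≡⟨ ≡.cong (λ k → fromℕ 2 * h ^ℕ (J ℕ.+ k)) (ℕ.+-identityʳ J) ⟩
          fromℕ 2 * h ^ℕ (J ℕ.+ J) ≈⟨ *-congˡ (^ℕ-+ h J J) ⟩
          fromℕ 2 * (w * w)      ∎

        2≤3w : fromℕ 2 ≤ fromℕ 3 * w
        2≤3w = ≮⇒≥ λ 3w<2 → <⇒≱ {fromℕ 2 * ((fromℕ 3 * w) * (fromℕ 3 * w))} {fromℕ 9}
          (<-trans (*-monoʳ-< (fromℕ 2) 0<2 (square-< (*-nonNeg (fromℕ-nonNeg 3) (inj₁ 0<w)) 3w<2))
            (<-from-diff 0<1 (solve 0 (con (+ 1) := con (+ 9) :- con (+ 2) :* (con (+ 2) :* con (+ 2))) refl)))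
          (≤-from-diff (*-nonNeg (fromℕ-nonNeg 9) (x≤y⇒0≤y-x 1≤2ww))
            (solve 1 (λ w → con (+ 9) :* (con (+ 2) :* (w :* w) :- con (+ 1)) := con (+ 2) :* ((con (+ 3) :* w) :* (con (+ 3) :* w)) :- con (+ 9)) refl w))

        -- The difference 8 - 36 w (1 - w) factors as 4 (3 w - 2) (3 w - 1).
        9W≤8 : fromℕ 9 * W ≤ fromℕ 8
        9W≤8 = ≤-from-diff
          (*-nonNeg (fromℕ-nonNeg 4) (*-nonNeg (x≤y⇒0≤y-x 2≤3w) (+-nonNeg (x≤y⇒0≤y-x 2≤3w) (inj₁ 0<1))))
          (solve 1 (λ w → con (+ 4) :* ((con (+ 3) :* w :- con (+ 2)) :* ((con (+ 3) :* w :- con (+ 2)) :+ con (+ 1)))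
            := con (+ 8) :- con (+ 9) :* (con (+ 4) :* (w :* (con (+ 1) :- w)))) refl w)

        Wg⁴<1 : W * g ^ℕ 4 < 1#
        Wg⁴<1 = *-cancelˡ-< (fromℕ 9) (fromℕ-pos {9} (s≤s z≤n)) (begin-strict
          fromℕ 9 * (W * g ^ℕ 4)    ≈⟨ *-assoc _ _ _ ⟨
          fromℕ 9 * W * g ^ℕ 4      ≤⟨ *-mono-≤ (fromℕ-nonNeg 8) (^ℕ-nonNeg 4 (inj₁ 0<g)) 9W≤8 ≤-refl ⟩
          fromℕ 8 * g ^ℕ 4          <⟨ 8g⁴<9 ⟩
          fromℕ 9                   ≈⟨ *-identityʳ _ ⟨
          fromℕ 9 * 1#              ∎)

      -- Now e² ≤ b, and p < 1 allows both p-th powers to be removed, leaving 4 w (1 - w) (1 + b) <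
      -- 1 - b.
      core-large : N ℕ.≤ 2 ℕ.* J → J ≢ N →
        fromℕ 4 * (w * (1# - w)) * f (1# + b * b) < f (1# - e * e)
      core-large N≤2J J≢N = begin-strict
        W * f (1# + b * b)   ≤⟨ *-monoʳ-≤ W 0≤4w[1-w] (1≤x⇒x^p≤x (inj₁ p<1)
                                  (≤-from-diff (inj₁ (*-pos 0<b 0<b)) (solve 1 (λ x → x := con (+ 1) :+ x :- con (+ 1)) refl (b * b)))) ⟩
        W * (1# + b * b)     ≤⟨ *-monoʳ-≤ W 0≤4w[1-w] (+-mono-≤ ≤-refl bb≤b) ⟩
        -- Since W = 1 - D, the gap is D b + (D - 2 b).
        W * (1# + b)         <⟨ <-from-diff (+-pos-nonNeg (*-pos 0<D 0<b) (x≤y⇒0≤y-x 2b≤D))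
          (solve 2 (λ w b → (con (+ 1) :- con (+ 2) :* w) :* (con (+ 1) :- con (+ 2) :* w) :* b
              :+ ((con (+ 1) :- con (+ 2) :* w) :* (con (+ 1) :- con (+ 2) :* w) :- con (+ 2) :* b)
            := con (+ 1) :- b :- con (+ 4) :* (w :* (con (+ 1) :- w)) :* (con (+ 1) :+ b)) refl w b) ⟩
        1# - b               ≤⟨ ≤-from-diff (x≤y⇒0≤y-x ee≤b) (solve 2 (λ x y → x :- y := con (+ 1) :- y :- (con (+ 1) :- x)) refl b (e * e)) ⟩
        1# - e * e           ≤⟨ x≤1⇒x≤x^p (inj₁ p<1) 0<1-ee
                                  (≤-from-diff (inj₁ (*-pos 0<e 0<e)) (solve 1 (λ x → x := con (+ 1) :- (con (+ 1) :- x)) refl (e * e))) ⟩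
        f (1# - e * e)       ∎
        where
        open ≤-Reasoning
        W D : Carrier
        W = fromℕ 4 * (w * (1# - w))
        D = (1# - fromℕ 2 * w) * (1# - fromℕ 2 * w)

        bb≤b : b * b ≤ b
        bb≤b = ≤-respʳ-≈ (*-identityʳ b) (*-monoʳ-≤ b (inj₁ 0<b) b≤1)

        ee≤b : e * e ≤ b
        ee≤b = ≤-respˡ-≈ (trans (reflexive (≡.cong (λ k → γ ^ℕ (J ℕ.+ k)) (ℕ.+-identityʳ J))) (^ℕ-+ γ J J))
          (^ℕ-antiʳ-≤ (inj₁ 0<γ) (inj₁ γ<1) N≤2J)

        -- At J = N one has 2 w = 1. Each index beyond N multiplies 2 w by h, so 1 - 2 w ≥ 1 - h;
        -- each index before N multiplies it by g, so 2 w - 1 ≥ g - 1, and g - 1 ≥ 1 - h because g h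
        -- = 1.
        ηη≤D : η * η ≤ D
        ηη≤D with ℕ.<-cmp J N
        ... | tri≈ _ J≡N _ = ⊥-elim (J≢N J≡N)
        ... | tri> _ _ N<J = square-≤ (inj₁ (x<y⇒0<y-x h<1))
          (≤-from-diff (x≤y⇒0≤y-x 2w≤h) (solve 2 (λ h w → h :- con (+ 2) :* w := con (+ 1) :- con (+ 2) :* w :- (con (+ 1) :- h)) refl h w))
          where
          2w≤h : fromℕ 2 * w ≤ h
          2w≤h = begin
            fromℕ 2 * w               ≤⟨ *-monoʳ-≤ (fromℕ 2) (inj₁ 0<2) (^ℕ-antiʳ-≤ (inj₁ 0<h) (inj₁ h<1) N<J) ⟩
            fromℕ 2 * (h * h ^ℕ N)    ≈⟨ solve 3 (λ t x y → t :* (x :* y) := (t :* y) :* x) refl (fromℕ 2) h (h ^ℕ N) ⟩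
            fromℕ 2 * h ^ℕ N * h      ≈⟨ trans (*-congʳ 2h^N≈1) (*-identityˡ h) ⟩
            h                         ∎
        ... | tri< J<N _ _ = ≤-respʳ-≈
          (solve 1 (λ x → (con (+ 2) :* x :- con (+ 1)) :* (con (+ 2) :* x :- con (+ 1))
                       := (con (+ 1) :- con (+ 2) :* x) :* (con (+ 1) :- con (+ 2) :* x)) refl w)
          (square-≤ (inj₁ (x<y⇒0<y-x h<1)) (begin
            1# - h                    ≤⟨ ≤-from-diff (*-nonNeg (x≤y⇒0≤y-x (inj₁ 1<g)) (x≤y⇒0≤y-x (inj₁ h<1)))
              (trans (solve 2 (λ g h → (g :- con (+ 1)) :* (con (+ 1) :- h) := g :- g :* h :- (con (+ 1) :- h)) refl g h)
                (+-congʳ (+-congˡ (-‿cong gh≈1)))) ⟩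
            g - 1#                    ≤⟨ ≤-from-diff (x≤y⇒0≤y-x g≤2w) (solve 2 (λ g x → x :- g := x :- con (+ 1) :- (g :- con (+ 1))) refl g (fromℕ 2 * w)) ⟩
            fromℕ 2 * w - 1#          ∎))
          where
          g≤2w : g ≤ fromℕ 2 * w
          g≤2w = begin
            g                           ≈⟨ trans (*-congˡ 2h^N≈1) (*-identityʳ g) ⟨
            g * (fromℕ 2 * h ^ℕ N)      ≤⟨ *-monoʳ-≤ g (inj₁ 0<g) (*-monoʳ-≤ (fromℕ 2) (inj₁ 0<2) (^ℕ-antiʳ-≤ (inj₁ 0<h) (inj₁ h<1) J<N)) ⟩
            g * (fromℕ 2 * (h * w))     ≈⟨ solve 4 (λ g t h w → g :* (t :* (h :* w)) := (g :* h) :* (t :* w)) refl g (fromℕ 2) h w ⟩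
            g * h * (fromℕ 2 * w)       ≈⟨ trans (*-congʳ gh≈1) (*-identityˡ _) ⟩
            fromℕ 2 * w                 ∎

        2b≤D : fromℕ 2 * b ≤ D
        2b≤D = ≤-trans 2b≤ηη ηη≤D

        0<D : 0# < D
        0<D = <-≤-trans (*-pos 0<2 0<b) 2b≤D

      core : J ≢ N → fromℕ 4 * (w * (1# - w)) * f (1# + b * b) < f (1# - e * e)
      core J≢N with ℕ.≤-total (2 ℕ.* J) N
      ... | inj₁ 2J≤N = core-small 2J≤N
      ... | inj₂ N≤2J = core-large N≤2J J≢N

      -- The value of |x|^p / (1 - |y|^p) at x = C J, |y| = γ^J is compared with its value at J = N,
      -- which is 2 f (C N). After multiplication by f δ the two size estimates apply, and f (α^N) =
      -- 2 and f (α^J) = 1/w reduce the claim to `core`.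
      convergents-worse : J ≢ N → fromℕ 2 * f (C N) * (1# - w) < f (C J)
      convergents-worse J≢N = *-cancelˡ-< (f δ) (^-pos p 0<δ) (begin-strict
        f δ * (fromℕ 2 * f (C N) * (1# - w))
          ≈⟨ solve 4 (λ d t c w → d :* (t :* c :* w) := t :* w :* (d :* c)) refl (f δ) (fromℕ 2) (f (C N)) (1# - w) ⟩
        fromℕ 2 * (1# - w) * (f δ * f (C N))
          ≈⟨ *-congˡ (sym (*-^-nonNeg 0<p 0<δ (fromℕ-nonNeg (c N)))) ⟩
        fromℕ 2 * (1# - w) * f (δ * C N)
          ≤⟨ *-monoʳ-≤ _ 0≤2[1-w] (^-mono-≤ 0<p (*-nonNeg (inj₁ 0<δ) (fromℕ-nonNeg (c N))) (≤-respʳ-≈ (α^+γ^ N) (δC-upper N))) ⟩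
        fromℕ 2 * (1# - w) * f (α ^ℕ N * (1# + b * b))
          ≈⟨ *-congˡ (trans (*-^ p (^ℕ-pos N 0<α) (+-pos 0<1 (*-pos 0<b 0<b))) (*-congʳ f[α^N]≈2)) ⟩
        fromℕ 2 * (1# - w) * (fromℕ 2 * f (1# + b * b))
          ≈⟨ trans (solve 2 (λ w x → con (+ 2) :* (con (+ 1) :- w) :* (con (+ 2) :* x) := con (+ 1) :* (con (+ 4) :* ((con (+ 1) :- w) :* x))) refl w (f (1# + b * b)))
               (*-congʳ (sym (gh^ J))) ⟩
        g ^ℕ J * w * (fromℕ 4 * ((1# - w) * f (1# + b * b)))
          ≈⟨ solve 4 (λ g w v x → g :* w :* (con (+ 4) :* (v :* x)) := g :* (con (+ 4) :* (w :* v) :* x)) refl (g ^ℕ J) w (1# - w) (f (1# + b * b)) ⟩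
        g ^ℕ J * (fromℕ 4 * (w * (1# - w)) * f (1# + b * b))
          <⟨ *-monoʳ-< (g ^ℕ J) (^ℕ-pos J 0<g) (core J≢N) ⟩
        g ^ℕ J * f (1# - e * e)
          ≈⟨ *-congʳ (^-^ℕ p J 0<α) ⟨
        f (α ^ℕ J) * f (1# - e * e)
          ≈⟨ *-^ p (^ℕ-pos J 0<α) 0<1-ee ⟨
        f (α ^ℕ J * (1# - e * e))
          ≤⟨ ^-mono-≤ 0<p (inj₁ (*-pos (^ℕ-pos J 0<α) 0<1-ee)) (≤-respˡ-≈ (α^-γ^ J) (δC-lower J)) ⟩
        f (δ * C J)
          ≈⟨ *-^-nonNeg 0<p 0<δ (fromℕ-nonNeg (c J)) ⟩
        f δ * f (C J) ∎)
        where
        open ≤-Reasoning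
        0≤2[1-w] : 0# ≤ fromℕ 2 * (1# - w)
        0≤2[1-w] = *-nonNeg (inj₁ 0<2) (x≤y⇒0≤y-x w≤1)

  -- Absolute values, and best approximation in terms of them.

  ∣∣-cases : ∀ x → (0# ≤ x × ∣ x ∣ ≈ x) ⊎ (x < 0# × ∣ x ∣ ≈ - x)
  ∣∣-cases x with compare x 0#
  ... | tri< x<0 _ _ = inj₂ (x<0 , refl)
  ... | tri≈ _ x≈0 _ = inj₁ (inj₂ (sym x≈0) , refl)
  ... | tri> _ _ 0<x = inj₁ (inj₁ 0<x , refl)

  ∣∣-nonNeg : ∀ x → 0# ≤ ∣ x ∣
  ∣∣-nonNeg x with ∣∣-cases x
  ... | inj₁ (0≤x , eq) = ≤-respʳ-≈ (sym eq) 0≤x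
  ... | inj₂ (x<0 , eq) = ≤-respʳ-≈ (sym eq) (inj₁ (neg-pos x<0))

  -- Characterises the absolute value independently of `compare`, so that congruence and scaling
  -- follow without unfolding its definition again.
  ∣∣-unique : ∀ {x y} → 0# ≤ y → x ≈ y ⊎ x ≈ - y → ∣ x ∣ ≈ y
  ∣∣-unique {x} {y} 0≤y x≈±y with ∣∣-cases x
  ... | inj₁ (0≤x , eq) = trans eq (nonNeg x≈±y)
    where
    nonNeg : x ≈ y ⊎ x ≈ - y → x ≈ y
    nonNeg (inj₁ x≈y)  = x≈y
    nonNeg (inj₂ x≈-y) = ≤-antisym
      (≤-from-diff (+-nonNeg 0≤y 0≤y) (trans (solve 1 (λ y → y :+ y := y :- (:- y)) refl y) (+-congˡ (-‿cong (sym x≈-y)))))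
      (≤-from-diff (+-nonNeg 0≤x 0≤x) (trans (+-congˡ x≈-y) refl))
  ... | inj₂ (x<0 , eq) = trans eq (neg x≈±y)
    where
    neg : x ≈ y ⊎ x ≈ - y → - x ≈ y
    neg (inj₁ x≈y)  = ⊥-elim (<⇒≱ x<0 (≤-respʳ-≈ (sym x≈y) 0≤y))
    neg (inj₂ x≈-y) = trans (-‿cong x≈-y) (solve 1 (λ y → :- (:- y) := y) refl y)

  ∣∣-nonNeg-id : ∀ {x} → 0# ≤ x → ∣ x ∣ ≈ x
  ∣∣-nonNeg-id 0≤x = ∣∣-unique 0≤x (inj₁ refl)

  ±∣∣ : ∀ x → x ≈ ∣ x ∣ ⊎ x ≈ - ∣ x ∣
  ±∣∣ x with ∣∣-cases x
  ... | inj₁ (_ , eq) = inj₁ (sym eq)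
  ... | inj₂ (_ , eq) = inj₂ (trans (solve 1 (λ x → x := :- (:- x)) refl x) (-‿cong (sym eq)))

  ∣∣-cong : ∀ {x y} → x ≈ y → ∣ x ∣ ≈ ∣ y ∣
  ∣∣-cong {x} {y} x≈y with ±∣∣ y
  ... | inj₁ y≈ = ∣∣-unique (∣∣-nonNeg y) (inj₁ (trans x≈y y≈))
  ... | inj₂ y≈ = ∣∣-unique (∣∣-nonNeg y) (inj₂ (trans x≈y y≈))

  ∣∣-*-pos : ∀ {z} x → 0# < z → ∣ z * x ∣ ≈ z * ∣ x ∣
  ∣∣-*-pos {z} x 0<z = ∣∣-unique (*-nonNeg (inj₁ 0<z) (∣∣-nonNeg x)) (scale (±∣∣ x))
    where
    scale : x ≈ ∣ x ∣ ⊎ x ≈ - ∣ x ∣ → z * x ≈ z * ∣ x ∣ ⊎ z * x ≈ - (z * ∣ x ∣)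
    scale (inj₁ eq) = inj₁ (*-congˡ eq)
    scale (inj₂ eq) = inj₂ (trans (*-congˡ eq) (solve 2 (λ z y → z :* (:- y) := :- (z :* y)) refl z ∣ x ∣))

  ∣∣-bounds : ∀ x → - ∣ x ∣ ≤ x × x ≤ ∣ x ∣
  ∣∣-bounds x with ±∣∣ x
  ... | inj₁ eq = ≤-from-diff (+-nonNeg (∣∣-nonNeg x) (∣∣-nonNeg x))
                    (trans (solve 1 (λ y → y :+ y := y :- (:- y)) refl ∣ x ∣) (+-congʳ (sym eq))) , inj₂ eq
  ... | inj₂ eq = inj₂ (sym eq) , ≤-from-diff (+-nonNeg (∣∣-nonNeg x) (∣∣-nonNeg x))
                    (trans (solve 1 (λ y → y :+ y := y :- (:- y)) refl ∣ x ∣) (+-congˡ (-‿cong (sym eq))))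

  ∣∣<1⇒Small : ∀ {x} → ∣ x ∣ < 1# → Small x
  ∣∣<1⇒Small {x} ∣x∣<1 =
    <-≤-trans (<-from-diff (x<y⇒0<y-x ∣x∣<1) (solve 1 (λ y → con (+ 1) :- y := :- y :- (:- con (+ 1))) refl ∣ x ∣)) (proj₁ (∣∣-bounds x)) ,
    ≤-<-trans (proj₂ (∣∣-bounds x)) ∣x∣<1

  C-≤-∣∣ : ∀ n {u v} → Dominates n u v ⊎ Dominates n (ℤ.- u) (ℤ.- v) → C (suc n) ≤ ∣ fromℤ v ∣
  C-≤-∣∣ n (inj₁ (_ , V , c≤V , _ , _ , ≡.refl)) =
    ≤-respʳ-≈ (sym (∣∣-nonNeg-id (fromℕ-nonNeg V))) (fromℕ-mono-≤ c≤V)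
  C-≤-∣∣ n {v = v} (inj₂ (_ , V , c≤V , _ , _ , -v≡V)) =
    ≤-respʳ-≈ (sym (∣∣-unique (fromℕ-nonNeg V) (inj₂ v≈-V))) (fromℕ-mono-≤ c≤V)
    where
    v≈-V : fromℤ v ≈ - fromℕ V
    v≈-V = trans (reflexive (≡.cong fromℤ (≡.trans (≡.sym (ℤ.neg-involutive v)) (≡.cong ℤ.-_ -v≡V)))) (fromℤ-neg (+ V))

  best-approximation : ∀ n u v → v ≢ + 0 → ∣ linearForm u v ∣ < γ ^ℕ n → C (suc n) ≤ ∣ fromℤ v ∣
  best-approximation n u v v≢0 y<γ^n = C-≤-∣∣ n {u} (dominates n u v v≢0 (∣∣<1⇒Small
    (<-respˡ-≈ (sym (∣∣-*-pos _ (^ℕ-pos n 0<α)))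
      (<-respʳ-≈ (αγ^ n) (*-monoʳ-< (α ^ℕ n) (^ℕ-pos n 0<α) y<γ^n)))))

  2<α^ : ∀ {N} → 1 ℕ.≤ N → fromℕ 8 * (fromℕ N * fromℕ N) ≤ α ^ℕ N → fromℕ 2 < α ^ℕ N
  2<α^ {N} 1≤N growth = <-≤-trans
    (<-from-diff (+-pos-nonNeg (fromℕ-pos {6} (s≤s z≤n)) (*-nonNeg (fromℕ-nonNeg 8) (x≤y⇒0≤y-x (square-≤ (inj₁ 0<1) 1≤fromℕN))))
      (solve 1 (λ x → con (+ 6) :+ con (+ 8) :* (x :* x :- con (+ 1) :* con (+ 1)) := con (+ 8) :* (x :* x) :- con (+ 2)) refl (fromℕ N)))
    growth
    where
    1≤fromℕN : 1# ≤ fromℕ N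
    1≤fromℕN = ≤-respˡ-≈ fromℕ-1 (fromℕ-mono-≤ 1≤N)

  -- The minimum over all lattice points off the y-axis.

  module Minimiser
    (N : ℕ) (36≤N : 36 ℕ.≤ N) (growth : fromℕ 8 * (fromℕ N * fromℕ N) ≤ α ^ℕ N)
    {p : Carrier} (0<p : 0# < p) (p<1 : p < 1#) (f[α^N]≈2 : (α ^ℕ N) ^ p ≈ fromℕ 2) where

    open Extremal N 36≤N growth 0<p p<1 f[α^N]≈2

    1≤N : 1 ℕ.≤ N
    1≤N = ℕ.≤-trans (s≤s z≤n) 36≤N

    1≤CN : 1# ≤ C N
    1≤CN = 1≤C 1≤N

    0<CN : 0# < C N
    0<CN = <-≤-trans 0<1 1≤CN

    -- The minimum of |x|^p / (1 - |y|^p): at the intended minimiser |y|^p is 1/2, whence the factor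
    -- 2.
    s₀ : Carrier
    s₀ = fromℕ 2 * f (C N)

    0<s₀ : 0# < s₀
    0<s₀ = *-pos 0<2 (^-pos p 0<CN)

    s₀h^N≈f[CN] : s₀ * h ^ℕ N ≈ f (C N)
    s₀h^N≈f[CN] = trans (solve 3 (λ t x y → t :* x :* y := t :* y :* x) refl (fromℕ 2) (f (C N)) (h ^ℕ N))
      (trans (*-congʳ 2h^N≈1) (*-identityˡ _))

    s₀[1-h^N]≈f[CN] : s₀ * (1# - h ^ℕ N) ≈ f (C N)
    s₀[1-h^N]≈f[CN] = trans (solve 2 (λ s y → s :* (con (+ 1) :- y) := s :- s :* y) refl s₀ (h ^ℕ N))
      (trans (+-congˡ (-‿cong s₀h^N≈f[CN])) (solve 1 (λ x → con (+ 2) :* x :- x := x) refl (f (C N))))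

    -- Nothing bounds |y| away from 0 in advance, so all heights below γ^(2N+1) are disposed of
    -- together: there |x| ≥ C (2N+2), and this alone makes |x|^p exceed (α^N C N)^p = `s₀`. Up to
    -- the factor δ and bounded terms the two sides are α^(2N) and α^(2N+2).
    α^NCN<C : α ^ℕ N * C N < C (2 ℕ.+ (N ℕ.+ N))
    α^NCN<C = *-cancelˡ-< δ 0<δ (begin-strict
      δ * (α ^ℕ N * C N)             ≈⟨ solve 3 (λ d x y → d :* (x :* y) := x :* (d :* y)) refl δ (α ^ℕ N) (C N) ⟩
      α ^ℕ N * (δ * C N)             ≤⟨ *-monoʳ-≤ (α ^ℕ N) (inj₁ (^ℕ-pos N 0<α)) (δC-upper N) ⟩
      α ^ℕ N * (α ^ℕ N + γ ^ℕ N)     ≈⟨ trans (distribˡ _ _ _) (+-congˡ (αγ^ N)) ⟩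
      S + 1#                         <⟨ <-from-diff (+-pos-nonNeg (x<y⇒0<y-x 2<S) (*-nonNeg (x≤y⇒0≤y-x 2≤αα) (inj₁ 0<S)))
        (solve 2 (λ x s → s :- con (+ 2) :+ (x :* x :- con (+ 2)) :* s := x :* (x :* s) :- con (+ 1) :- (s :+ con (+ 1))) refl α S) ⟩
      α * (α * S) - 1#               ≤⟨ ≤-from-diff (x≤y⇒0≤y-x (^ℕ≤1 K (inj₁ 0<γ) (inj₁ γ<1)))
        (trans (solve 2 (λ x y → con (+ 1) :- y := x :- y :- (x :- con (+ 1))) refl (α * (α * S)) (γ ^ℕ K))
               (+-congʳ (+-congʳ (*-congˡ (*-congˡ (sym (^ℕ-+ α N N))))))) ⟩
      α ^ℕ K - γ ^ℕ K                ≤⟨ δC-lower K ⟩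
      δ * C K                        ∎)
      where
      open ≤-Reasoning
      K = 2 ℕ.+ (N ℕ.+ N)
      S = α ^ℕ N * α ^ℕ N
      0<S : 0# < S
      0<S = *-pos (^ℕ-pos N 0<α) (^ℕ-pos N 0<α)
      2<S : fromℕ 2 < S
      2<S = <-≤-trans (2<α^ 1≤N growth) (≤-respˡ-≈ (*-identityʳ _)
        (*-monoʳ-≤ (α ^ℕ N) (inj₁ (^ℕ-pos N 0<α)) (1≤^ℕ N (inj₁ 1<α))))

    s₀<f[C] : s₀ < f (C (2 ℕ.+ (N ℕ.+ N)))
    s₀<f[C] = <-respˡ-≈ (trans (*-^ p (^ℕ-pos N 0<α) 0<CN) (*-congʳ f[α^N]≈2))
      (^-mono-< 0<p (inj₁ (*-pos (^ℕ-pos N 0<α) 0<CN)) α^NCN<C)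

    module _ (u v : ℤ) (v≢0 : v ≢ + 0) where
      private
        X Y : Carrier
        X = ∣ fromℤ v ∣
        Y = ∣ linearForm u v ∣
        0≤X = ∣∣-nonNeg (fromℤ v)
        0≤Y = ∣∣-nonNeg (linearForm u v)

        0<X : 0# < X
        0<X = ≤∧≉⇒< 0≤X (λ 0≈X → v≢0 (small-integer v (v-small 0≈X)))
          where
          ≤∧≉⇒< : ∀ {x y} → x ≤ y → ¬ (x ≈ y) → x < y
          ≤∧≉⇒< (inj₁ x<y) _   = x<y
          ≤∧≉⇒< (inj₂ x≈y) x≉y = ⊥-elim (x≉y x≈y)
          v-small : 0# ≈ X → Small (fromℤ v)
          v-small 0≈X = ∣∣<1⇒Small (<-respˡ-≈ 0≈X 0<1)

      -- The quotient is cleared of its denominator so that heights |y| ≥ 1 are covered as well. The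
      -- tie is kept apart because the choice of the next point depends on knowing exactly which
      -- points attain the minimum.
      AboveMinimum : Set
      AboveMinimum = s₀ * (1# - f Y) < f X ⊎ (X ≈ C N × Y ≈ b)

      private
        f[γ^] : ∀ k → f (γ ^ℕ k) ≈ h ^ℕ k
        f[γ^] k = ^-^ℕ p k 0<γ

        mono-Y : ∀ {k} → γ ^ℕ k ≤ Y → s₀ * (1# - f Y) ≤ s₀ * (1# - h ^ℕ k)
        mono-Y {k} γ^k≤Y = *-monoʳ-≤ s₀ (inj₁ 0<s₀) (≤-from-diff
          (x≤y⇒0≤y-x (≤-respˡ-≈ (f[γ^] k) (^-mono-≤ 0<p (^ℕ-nonNeg k (inj₁ 0<γ)) γ^k≤Y)))
          (solve 2 (λ x y → x :- y := con (+ 1) :- y :- (con (+ 1) :- x)) refl (f Y) (h ^ℕ k)))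

        at-N : C N ≤ X → b ≤ Y → AboveMinimum
        at-N (inj₁ CN<X) b≤Y = inj₁ (≤-<-trans (mono-Y {N} b≤Y) (<-respˡ-≈ (sym s₀[1-h^N]≈f[CN]) (^-mono-< 0<p (inj₁ 0<CN) CN<X)))
        at-N (inj₂ CN≈X) (inj₂ b≈Y) = inj₂ (sym CN≈X , sym b≈Y)
        at-N (inj₂ CN≈X) (inj₁ b<Y) = inj₁ (<-respʳ-≈ (trans s₀[1-h^N]≈f[CN] (^-cong CN≈X refl))
          (*-monoʳ-< s₀ 0<s₀ (<-from-diff
            (x<y⇒0<y-x (<-respˡ-≈ (f[γ^] N) (^-mono-< 0<p (inj₁ 0<b) b<Y)))
            (solve 2 (λ x y → x :- y := con (+ 1) :- y :- (con (+ 1) :- x)) refl (f Y) (h ^ℕ N)))))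

        -- Descends until Y lies between γ^(k+1) and γ^k. The lower end bounds 1 - Y^p from above
        -- and the upper end gives X ≥ C (k+1); both bounds are sharp at the convergent (C (k+1) ,
        -- γ^(k+1)), so only the comparison of convergents remains. At k = 0 the left side is
        -- nonpositive while X^p is positive.
        bracket : ∀ k → γ ^ℕ k ≤ Y → AboveMinimum
        bracket zero 1≤Y = inj₁ (≤-<-trans (≤-respʳ-≈ (solve 1 (λ s → s :* (con (+ 1) :- con (+ 1)) := con (+ 0)) refl s₀) (mono-Y {0} 1≤Y)) (^-pos p 0<X))
        bracket (suc k) γ^1+k≤Y with <-or-≥ Y (γ ^ℕ k)
        ... | inj₂ γ^k≤Y = bracket k γ^k≤Y
        ... | inj₁ Y<γ^k with suc k ℕ.≟ N
        ...   | yes ≡.refl = at-N (best-approximation k u v v≢0 Y<γ^k) γ^1+k≤Y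
        ...   | no  J≢N    = inj₁ (≤-<-trans (mono-Y {suc k} γ^1+k≤Y) (<-≤-trans (convergents-worse (suc k) (s≤s z≤n) J≢N)
                               (^-mono-≤ 0<p (fromℕ-nonNeg (c (suc k))) (best-approximation k u v v≢0 Y<γ^k))))

      lattice-minimum : AboveMinimum
      lattice-minimum with <-or-≥ Y (γ ^ℕ suc (N ℕ.+ N))
      ... | inj₂ γ^≤Y = bracket (suc (N ℕ.+ N)) γ^≤Y
      ... | inj₁ Y<γ^ = inj₁ (begin-strict
        s₀ * (1# - f Y)          ≤⟨ ≤-from-diff (*-nonNeg (inj₁ 0<s₀) (^-nonNeg 0<p 0≤Y)) (solve 2 (λ s y → s :* y := s :- s :* (con (+ 1) :- y)) refl s₀ (f Y)) ⟩
        s₀                       <⟨ s₀<f[C] ⟩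
        f (C (2 ℕ.+ (N ℕ.+ N)))  ≤⟨ ^-mono-≤ 0<p (fromℕ-nonNeg (c (2 ℕ.+ (N ℕ.+ N)))) (best-approximation (suc (N ℕ.+ N)) u v v≢0 Y<γ^) ⟩
        f X                      ∎)
        where open ≤-Reasoning

  -- Balls in terms of p-th powers.

  -- t ^ p times the p-th power of F[ t ] p.
  weight : Carrier → Carrier → Point → Carrier
  weight p t (x , y) = ∣ x ∣ ^ p + t ^ p * t ^ p * ∣ y ∣ ^ p

  weight-cong : ∀ {p t P Q} → P ≋ Q → weight p t P ≈ weight p t Q
  weight-cong (x≈ , y≈) = +-cong (^-cong (∣∣-cong x≈) refl) (*-congˡ (^-cong (∣∣-cong y≈) refl))

  module _ {p : Carrier} (0<p : 0# < p) where

    private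
      inner : Carrier → Point → Carrier
      inner t (x , y) = ∣ t ⁻¹ * x ∣ ^ p + ∣ t * y ∣ ^ p

      0<1/p : 0# < 1# / p
      0<1/p = *-pos 0<1 (⁻¹-pos 0<p)

      inner-nonNeg : ∀ t P → 0# ≤ inner t P
      inner-nonNeg t (x , y) = +-nonNeg (^-nonNeg 0<p (∣∣-nonNeg _)) (^-nonNeg 0<p (∣∣-nonNeg _))

      inner-scale : ∀ {t} → 0# < t → ∀ P → t ^ p * inner t P ≈ weight p t P
      inner-scale {t} 0<t (x , y) = begin
        t ^ p * (∣ t ⁻¹ * x ∣ ^ p + ∣ t * y ∣ ^ p)
          ≈⟨ distribˡ _ _ _ ⟩
        t ^ p * ∣ t ⁻¹ * x ∣ ^ p + t ^ p * ∣ t * y ∣ ^ p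
          ≈⟨ +-cong (sym (*-^-nonNeg 0<p 0<t (∣∣-nonNeg _))) (*-congˡ (^-cong (∣∣-*-pos y 0<t) refl)) ⟩
        (t * ∣ t ⁻¹ * x ∣) ^ p + t ^ p * (t * ∣ y ∣) ^ p
          ≈⟨ +-cong (^-cong t∣x/t∣≈∣x∣ refl) (*-congˡ (*-^-nonNeg 0<p 0<t (∣∣-nonNeg y))) ⟩
        ∣ x ∣ ^ p + t ^ p * (t ^ p * ∣ y ∣ ^ p)
          ≈⟨ +-congˡ (*-assoc _ _ _) ⟨
        ∣ x ∣ ^ p + t ^ p * t ^ p * ∣ y ∣ ^ p ∎
        where
        open import Relation.Binary.Reasoning.Setoid setoid
        t∣x/t∣≈∣x∣ : t * ∣ t ⁻¹ * x ∣ ≈ ∣ x ∣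
        t∣x/t∣≈∣x∣ = trans (*-congˡ (∣∣-*-pos x (⁻¹-pos 0<t)))
          (trans (sym (*-assoc _ _ _)) (trans (*-congʳ (⁻¹-inverseʳ (0<⇒≉0 0<t))) (*-identityˡ _)))

    F<⇒weight< : ∀ {t} → 0# < t → ∀ {P Q} → F[ t ] p P < F[ t ] p Q → weight p t P < weight p t Q
    F<⇒weight< {t} 0<t {P} {Q} F< = <-respˡ-≈ (inner-scale 0<t P) (<-respʳ-≈ (inner-scale 0<t Q)
      (*-monoʳ-< (t ^ p) (^-pos p 0<t) (^-cancel-< 0<1/p (inner-nonNeg t Q) F<)))

    weight<⇒F< : ∀ {t} → 0# < t → ∀ {P Q} → weight p t P < weight p t Q → F[ t ] p P < F[ t ] p Q
    weight<⇒F< {t} 0<t {P} {Q} w< = ^-mono-< 0<1/p (inner-nonNeg t P) (*-cancelˡ-< (t ^ p) (^-pos p 0<t)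
      (<-respˡ-≈ (sym (inner-scale 0<t P)) (<-respʳ-≈ (sym (inner-scale 0<t Q)) w<)))

    F≈⇒weight≈ : ∀ {t} → 0# < t → ∀ {P Q} → F[ t ] p P ≈ F[ t ] p Q → weight p t P ≈ weight p t Q
    F≈⇒weight≈ {t} 0<t {P} {Q} F≈ = trans (sym (inner-scale 0<t P)) (trans
      (*-congˡ (^-cancel-≈ 0<1/p (inner-nonNeg t P) (inner-nonNeg t Q) F≈)) (inner-scale 0<t Q))

    weight≈⇒F≈ : ∀ {t} → 0# < t → ∀ {P Q} → weight p t P ≈ weight p t Q → F[ t ] p P ≈ F[ t ] p Q
    weight≈⇒F≈ {t} 0<t {P} {Q} w≈ = ^-cong (*-cancelˡ-≈ (t ^ p) (^-pos p 0<t)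
      (trans (inner-scale 0<t P) (trans w≈ (sym (inner-scale 0<t Q))))) refl

    ∣0∣^p≈0 : ∣ 0# ∣ ^ p ≈ 0#
    ∣0∣^p≈0 = trans (^-cong (∣∣-nonNeg-id ≤-refl) refl) (^-zeroˡ 0<p)

    weight-start : ∀ t → weight p t (0# , 1#) ≈ t ^ p * t ^ p
    weight-start t = trans (+-cong ∣0∣^p≈0 (*-congˡ (trans (^-cong (∣∣-nonNeg-id (inj₁ 0<1)) refl) (1^ p))))
      (trans (+-identityˡ _) (*-identityʳ _))

    weight-origin : ∀ t → weight p t origin ≈ 0#
    weight-origin t = trans (+-cong ∣0∣^p≈0 (trans (*-congˡ ∣0∣^p≈0) (zeroʳ _))) (+-identityˡ _)

  -- The first step of the algorithm.

  module InitialConvergent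
    (N : ℕ) (36≤N : 36 ℕ.≤ N) (growth : fromℕ 8 * (fromℕ N * fromℕ N) ≤ α ^ℕ N)
    {p : Carrier} (0<p : 0# < p) (p<1 : p < 1#) (f[α^N]≈2 : (α ^ℕ N) ^ p ≈ fromℕ 2) where

    open Extremal N 36≤N growth 0<p p<1 f[α^N]≈2
    open Minimiser N 36≤N growth 0<p p<1 f[α^N]≈2

    -- The lattice point of p_m / q_m: for N = m + 1 the integers are p_m = `c (suc N)` and q_m =
    -- `c N`.
    P₀ : Point
    P₀ = fromℤ (+ c N) , linearForm (+ c (suc N)) (+ c N)

    y₀≈ : linearForm (+ c (suc N)) (+ c N) ≈ (- γ) ^ℕ N
    y₀≈ = trans (+-congʳ (C-suc N))
      (solve 3 (λ x y z → x :* y :+ z :+ y :* (:- x) := z) refl α (C N) ((- γ) ^ℕ N))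

    ∣y₀∣≈b : ∣ linearForm (+ c (suc N)) (+ c N) ∣ ≈ b
    ∣y₀∣≈b = ∣∣-unique (inj₁ 0<b) (±y₀ (neg-^ℕ γ N))
      where
      ±y₀ : (- γ) ^ℕ N ≈ b ⊎ (- γ) ^ℕ N ≈ - b → linearForm (+ c (suc N)) (+ c N) ≈ b ⊎ linearForm (+ c (suc N)) (+ c N) ≈ - b
      ±y₀ (inj₁ eq) = inj₁ (trans y₀≈ eq)
      ±y₀ (inj₂ eq) = inj₂ (trans y₀≈ eq)

    -- The time at which `P₀` and (0 , 1) have equal weight: C_N^p + t^(2p) / 2 = t^(2p) means
    -- t^(2p) = 2 C_N^p, and 2 is the p-th power of α^N.
    t₀² t₀ : Carrier
    t₀² = α ^ℕ N * C N
    t₀ = √ t₀²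

    0<t₀² : 0# < t₀²
    0<t₀² = *-pos (^ℕ-pos N 0<α) 0<CN

    0<t₀ : 0# < t₀
    0<t₀ = ^-pos ½ 0<t₀²

    f[t₀]²≈s₀ : f t₀ * f t₀ ≈ s₀
    f[t₀]²≈s₀ = begin
      f t₀ * f t₀              ≈⟨ *-^ p 0<t₀ 0<t₀ ⟨
      f (t₀ * t₀)              ≈⟨ ^-cong (√-square 0<t₀²) refl ⟩
      f t₀²                    ≈⟨ *-^ p (^ℕ-pos N 0<α) 0<CN ⟩
      f (α ^ℕ N) * f (C N)     ≈⟨ *-congʳ f[α^N]≈2 ⟩
      s₀                       ∎
      where open import Relation.Binary.Reasoning.Setoid setoid

    1≤t₀ : 1# ≤ t₀
    1≤t₀ = ≮⇒≥ λ t₀<1 → <⇒≱ {t₀²} {1#}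
      (<-respˡ-≈ (√-square 0<t₀²) (<-respʳ-≈ (*-identityˡ 1#) (square-< (inj₁ 0<t₀) t₀<1)))
      (≤-respˡ-≈ (*-identityˡ 1#) (*-mono-≤ (inj₁ (^ℕ-pos N 0<α)) (inj₁ 0<1) (1≤^ℕ N (inj₁ 1<α)) 1≤CN))

    weight-P₀ : ∀ t → weight p t P₀ ≈ f (C N) + f t * f t * h ^ℕ N
    weight-P₀ t = +-cong (^-cong (∣∣-nonNeg-id (fromℕ-nonNeg (c N))) refl)
      (*-congˡ (trans (^-cong ∣y₀∣≈b refl) (^-^ℕ p N 0<γ)))

    Start : Point
    Start = 0# , 1#

    origin∈Ball : ∀ {t} → 0# < t → origin ∈ Ball p t Start
    origin∈Ball {t} 0<t = weight<⇒F< 0<p 0<t {origin} {Start}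
      (<-respˡ-≈ (sym (weight-origin 0<p t)) (<-respʳ-≈ (sym (weight-start 0<p t)) (*-pos (^-pos p 0<t) (^-pos p 0<t))))

    integer-in-Ball : ∀ {t} u → 0# < t → (f ∣ 0# ∣) + f t * f t * (f ∣ fromℤ u ∣) < f t * f t → u ≡ + 0
    integer-in-Ball {t} u 0<t inBall = small-integer u u-small
      where
      0<ff = *-pos (^-pos p 0<t) (^-pos p 0<t)
      u-small : Small (fromℤ u)
      u-small = ∣∣<1⇒Small (^-cancel-< 0<p (inj₁ 0<1) (<-respʳ-≈ (sym (1^ p)) (*-cancelˡ-< (f t * f t) 0<ff
        (<-respˡ-≈ (trans (+-congʳ (∣0∣^p≈0 0<p)) (+-identityˡ _)) (<-respʳ-≈ (sym (*-identityʳ _)) inBall)))))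

    -- A point in the ball with x ≠ 0 would satisfy |x|^p < t^(2p) (1 - |y|^p) ≤ s₀ (1 - |y|^p),
    -- against the minimality of `s₀`. On the y-axis the ball leaves only integers of absolute value
    -- below 1.
    admissible : ∀ {t} → 0# < t → t ≤ t₀ → Admissible (Lattice α) (Ball p t Start)
    admissible {t} 0<t t≤t₀ = origin∈Ball 0<t , λ P (u , v , P≋) P∈Ball →
      point P u v P≋ (<-respˡ-≈ (weight-cong P≋) (<-respʳ-≈ (weight-start 0<p t) (F<⇒weight< 0<p 0<t {P} {Start} P∈Ball)))
      where
      ff = f t * f t

      ff≤s₀ : ff ≤ s₀
      ff≤s₀ = ≤-respʳ-≈ f[t₀]²≈s₀ (square-≤ (inj₁ (^-pos p 0<t)) (^-mono-≤ 0<p (inj₁ 0<t) t≤t₀))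

      nonzero : ∀ u v → v ≢ + 0 → ¬ (weight p t (fromℤ v , linearForm u v) < ff)
      nonzero u v v≢0 inBall = <⇒≱ fX< (≤-trans (≤-respˡ-≈ (*-comm _ _) (≤-respʳ-≈ (*-comm _ _) (*-monoʳ-≤ (1# - fY) (inj₁ 0<1-fY) ff≤s₀))) minimal)
        where
        fX = f ∣ fromℤ v ∣
        fY = f ∣ linearForm u v ∣

        fX< : fX < ff * (1# - fY)
        fX< = <-from-diff (x<y⇒0<y-x inBall)
          (solve 3 (λ x y s → s :- (x :+ s :* y) := s :* (con (+ 1) :- y) :- x) refl fX fY ff)

        0<1-fY : 0# < 1# - fY
        0<1-fY = *-cancelˡ-< ff (*-pos (^-pos p 0<t) (^-pos p 0<t))
          (<-respˡ-≈ (sym (zeroʳ ff)) (≤-<-trans (^-nonNeg 0<p (∣∣-nonNeg _)) fX<))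

        minimal : s₀ * (1# - fY) ≤ fX
        minimal with lattice-minimum u v v≢0
        ... | inj₁ strict = inj₁ strict
        ... | inj₂ (X≈CN , Y≈b) = inj₂ (trans (*-congˡ (+-congˡ (-‿cong (trans (^-cong Y≈b refl) (^-^ℕ p N 0<γ)))))
                (trans s₀[1-h^N]≈f[CN] (^-cong (sym X≈CN) refl)))

      point : ∀ P u v → P ≋ (fromℤ v , linearForm u v) → weight p t (fromℤ v , linearForm u v) < ff → P ≋ origin
      point P u v (x≈ , y≈) inBall with v ℤ.≟ + 0
      ... | no v≢0 = ⊥-elim (nonzero u v v≢0 inBall)
      ... | yes ≡.refl = x≈ , trans y≈ (trans (linearForm≈0 {u} ≡.refl) (reflexive (≡.cong fromℤ
              (integer-in-Ball u 0<t (<-respˡ-≈ (+-congˡ (*-congˡ (^-cong (∣∣-cong (linearForm≈0 {u} ≡.refl)) refl))) inBall)))))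

    isNextTime : IsNextTime p α 1# Start t₀
    isNextTime = (1≤t₀ , λ τ 1≤τ τ≤t₀ → admissible (<-≤-trans 0<1 1≤τ) τ≤t₀) , upper
      where
      upper : UpperBound (AdmissibleUpTo p α 1# Start) t₀
      -- Admissibility is demanded at T itself, and for T > t₀ it fails there: `P₀` lies inside by
      -- the margin (T^(2p) - s₀) (1 - h^N).
      upper T (1≤T , adm) = ≮⇒≥ λ t₀<T → 0<⇒≉0 0<CN (proj₁ (proj₂ (adm T 1≤T ≤-refl) P₀
        (+ c (suc N) , + c N , refl , refl) (P₀∈Ball t₀<T)))
        where
        0<T = <-≤-trans 0<1 1≤T
        P₀∈Ball : t₀ < T → P₀ ∈ Ball p T Start
        P₀∈Ball t₀<T = weight<⇒F< 0<p 0<T {P₀} {Start}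
          (<-respˡ-≈ (sym (weight-P₀ T)) (<-respʳ-≈ (sym (weight-start 0<p T)) (<-from-diff
            (*-pos (x<y⇒0<y-x s₀<f[T]²) 0<1-h^N)
            (trans
              (solve 3 (λ ff s w → (ff :- s) :* (con (+ 1) :- w) := ff :- (s :* (con (+ 1) :- w) :+ ff :* w))
                refl (f T * f T) s₀ (h ^ℕ N))
              (+-congˡ (-‿cong (+-congʳ s₀[1-h^N]≈f[CN])))))))
          where
          s₀<f[T]² : s₀ < f T * f T
          s₀<f[T]² = <-respˡ-≈ f[t₀]²≈s₀ (square-< (inj₁ (^-pos p 0<t₀)) (^-mono-< 0<p (inj₁ 0<t₀) t₀<T))

          0<1-h^N : 0# < 1# - h ^ℕ N
          0<1-h^N = *-cancelˡ-< s₀ 0<s₀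
            (<-respˡ-≈ (sym (zeroʳ s₀)) (<-respʳ-≈ (sym s₀[1-h^N]≈f[CN]) (^-pos p 0<CN)))

    onBoundary-P₀ : P₀ ∈ OnBoundary p α t₀ Start
    onBoundary-P₀ = (+ c (suc N) , + c N , refl , refl) , weight≈⇒F≈ 0<p 0<t₀ {P₀} {Start} (begin
      weight p t₀ P₀                  ≈⟨ weight-P₀ t₀ ⟩
      f (C N) + f t₀ * f t₀ * h ^ℕ N    ≈⟨ +-congˡ (trans (*-congʳ f[t₀]²≈s₀) s₀h^N≈f[CN]) ⟩
      f (C N) + f (C N)                 ≈⟨ solve 1 (λ x → x :+ x := con (+ 2) :* x) refl (f (C N)) ⟩
      s₀                                ≈⟨ f[t₀]²≈s₀ ⟨
      f t₀ * f t₀                       ≈⟨ weight-start 0<p t₀ ⟨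
      weight p t₀ Start               ∎)
      where open import Relation.Binary.Reasoning.Setoid setoid

    2b<1 : fromℕ 2 * b < 1#
    2b<1 = ≤-<-trans 2b≤ηη (<-respʳ-≈ (*-identityˡ 1#) (square-< (inj₁ (x<y⇒0<y-x h<1))
      (<-from-diff 0<h (solve 1 (λ x → x := con (+ 1) :- (con (+ 1) :- x)) refl h))))

    boundary-tie : ∀ u v → v ≢ + 0 → weight p t₀ (fromℤ v , linearForm u v) ≈ s₀ →
                   ∣ fromℤ v ∣ ≈ C N × ∣ linearForm u v ∣ ≈ b
    boundary-tie u v v≢0 w≈s₀ with lattice-minimum u v v≢0
    ... | inj₂ tie = tie
    ... | inj₁ strict = ⊥-elim (<-irrefl (sym w≈s₀) (<-from-diff (x<y⇒0<y-x strict)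
      (trans (solve 3 (λ s x y → x :- s :* (con (+ 1) :- y) := x :+ s :* y :- s) refl s₀ (f ∣ fromℤ v ∣) (f ∣ linearForm u v ∣))
        (+-congʳ (+-congˡ (*-congʳ (sym f[t₀]²≈s₀)))))))

    -- Lattice points with the same x differ in y by an integer, here of absolute value at most 2 b
    -- < 1.
    tie-unique : ∀ u v → fromℤ v ≈ C N → ∣ linearForm u v ∣ ≈ b → linearForm u v ≈ linearForm (+ c (suc N)) (+ c N)
    tie-unique u v v≈CN ∣y∣≈b = trans (solve 2 (λ y z → y := z :+ (y :- z)) refl y y₀)
      (trans (+-congˡ y-y₀≈0) (+-identityʳ y₀))
      where
      y = linearForm u v
      y₀ = linearForm (+ c (suc N)) (+ c N)
      k = u ℤ.- + c (suc N)

      y-y₀≈k : y - y₀ ≈ fromℤ k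
      y-y₀≈k = trans (+-congʳ (+-congˡ (*-congʳ v≈CN)))
        (trans (solve 4 (λ u w x z → (u :+ x :* (:- z)) :- (w :+ x :* (:- z)) := u :- w) refl (fromℤ u) (C (suc N)) (C N) α)
          (sym (trans (fromℤ-+ u (ℤ.- + c (suc N))) (+-congˡ (fromℤ-neg (+ c (suc N)))))))

      bounds : ∀ {x} → ∣ x ∣ ≈ b → - b ≤ x × x ≤ b
      bounds {x} eq = ≤-respˡ-≈ (-‿cong eq) (proj₁ (∣∣-bounds x)) , ≤-respʳ-≈ eq (proj₂ (∣∣-bounds x))

      0≤1-2b = x<y⇒0<y-x 2b<1

      k-small : Small (fromℤ k)
      k-small = Small-resp y-y₀≈k
        ( <-from-diff (+-pos-nonNeg 0≤1-2b (+-nonNeg (x≤y⇒0≤y-x (proj₁ (bounds ∣y∣≈b))) (x≤y⇒0≤y-x (proj₂ (bounds ∣y₀∣≈b)))))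
            (solve 3 (λ b y z → con (+ 1) :- con (+ 2) :* b :+ ((y :- (:- b)) :+ (b :- z)) := y :- z :- (:- con (+ 1))) refl b y y₀)
        , <-from-diff (+-pos-nonNeg 0≤1-2b (+-nonNeg (x≤y⇒0≤y-x (proj₂ (bounds ∣y∣≈b))) (x≤y⇒0≤y-x (proj₁ (bounds ∣y₀∣≈b)))))
            (solve 3 (λ b y z → con (+ 1) :- con (+ 2) :* b :+ ((b :- y) :+ (z :- (:- b))) := con (+ 1) :- (y :- z)) refl b y y₀))

      y-y₀≈0 : y - y₀ ≈ 0#
      y-y₀≈0 = trans y-y₀≈k (reflexive (≡.cong fromℤ (small-integer k k-small)))

    -- The boundary also contains -P₀ and points with x = 0 such as (0 , 1). All others are ties in
    -- the minimum, so |x| = C N, and the largest x singles out `P₀`.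
    isNextPoint : IsNextPoint p α t₀ Start P₀
    isNextPoint = onBoundary-P₀ , λ Q ((u , v , Q≋) , F≈) → furthest Q u v Q≋
      (trans (sym (weight-cong Q≋)) (trans (F≈⇒weight≈ 0<p 0<t₀ {Q} {Start} F≈) (trans (weight-start 0<p t₀) f[t₀]²≈s₀)))
      where
      furthest : ∀ Q u v → Q ≋ (fromℤ v , linearForm u v) → weight p t₀ (fromℤ v , linearForm u v) ≈ s₀ →
                 proj₁ Q ≤ C N × (proj₁ Q ≈ C N → Q ≋ P₀)
      furthest Q u v (x≈ , y≈) w≈s₀ with v ℤ.≟ + 0
      ... | yes ≡.refl = ≤-respˡ-≈ (sym x≈) (inj₁ 0<CN) , λ x≈CN → ⊥-elim (0<⇒≉0 0<CN (trans (sym x≈CN) x≈))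
      ... | no v≢0 with boundary-tie u v v≢0 w≈s₀
      ...   | ∣v∣≈CN , ∣y∣≈b = ≤-respˡ-≈ (sym x≈) (≤-respʳ-≈ ∣v∣≈CN (proj₂ (∣∣-bounds (fromℤ v)))) ,
                λ x≈CN → x≈CN , trans y≈ (tie-unique u v (trans (sym x≈) x≈CN) ∣y∣≈b)

    isPConvergent : IsPConvergent p α 0 (+ c (suc N)) (+ c N)
    isPConvergent = t₀ , P₀ , next start isNextTime isNextPoint , refl ,
      solve 3 (λ x y z → x := x :+ y :* (:- z) :+ y :* z) refl (C (suc N)) (C N) α

  -- Exponential growth of α^N against N².

  -- Here k = 14 + j, and 29 + 2 j = 2 k + 1 is the largest N with N / 2 = k, so both parities of N
  -- are covered. Together with α² ≥ 2 this yields the growth condition.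
  8[2k+1]²≤2^k : ∀ j → 8 ℕ.* ((29 ℕ.+ 2 ℕ.* j) ℕ.* (29 ℕ.+ 2 ℕ.* j)) ℕ.≤ 2 ℕ.^ (14 ℕ.+ j)
  8[2k+1]²≤2^k zero = ℕ.≤ᵇ⇒≤ (8 ℕ.* (29 ℕ.* 29)) (2 ℕ.^ 14) _
  8[2k+1]²≤2^k (suc j) = begin
    8 ℕ.* ((29 ℕ.+ 2 ℕ.* suc j) ℕ.* (29 ℕ.+ 2 ℕ.* suc j))
      -- The added polynomial is the amount by which twice the old left side exceeds the new one.
      ≤⟨ ℕ.m≤m+n _ (32 ℕ.* (j ℕ.* j) ℕ.+ 864 ℕ.* j ℕ.+ 5768) ⟩
    8 ℕ.* ((29 ℕ.+ 2 ℕ.* suc j) ℕ.* (29 ℕ.+ 2 ℕ.* suc j)) ℕ.+ (32 ℕ.* (j ℕ.* j) ℕ.+ 864 ℕ.* j ℕ.+ 5768)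
      ≡⟨ identity j ⟩
    2 ℕ.* (8 ℕ.* ((29 ℕ.+ 2 ℕ.* j) ℕ.* (29 ℕ.+ 2 ℕ.* j)))
      ≤⟨ ℕ.*-monoʳ-≤ 2 (8[2k+1]²≤2^k j) ⟩
    2 ℕ.* 2 ℕ.^ (14 ℕ.+ j)
      ≡⟨ ≡.cong (2 ℕ.^_) (ℕ.+-suc 14 j) ⟨
    2 ℕ.^ (14 ℕ.+ suc j) ∎
    where
    open ℕ.≤-Reasoning
    identity : ∀ j → 8 ℕ.* ((29 ℕ.+ 2 ℕ.* suc j) ℕ.* (29 ℕ.+ 2 ℕ.* suc j)) ℕ.+ (32 ℕ.* (j ℕ.* j) ℕ.+ 864 ℕ.* j ℕ.+ 5768)
                   ≡ 2 ℕ.* (8 ℕ.* ((29 ℕ.+ 2 ℕ.* j) ℕ.* (29 ℕ.+ 2 ℕ.* j)))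
    identity = solve-∀

  fromℕ-2^ : ∀ k → fromℕ (2 ℕ.^ k) ≈ fromℕ 2 ^ℕ k
  fromℕ-2^ zero    = fromℕ-1
  fromℕ-2^ (suc k) = trans (fromℕ-* 2 (2 ℕ.^ k)) (*-congˡ (fromℕ-2^ k))

  8NN≤α^N : ∀ N → 28 ℕ.≤ N → fromℕ 8 * (fromℕ N * fromℕ N) ≤ α ^ℕ N
  8NN≤α^N N 28≤N = begin
    fromℕ 8 * (fromℕ N * fromℕ N)  ≈⟨ trans (fromℕ-* 8 (N ℕ.* N)) (*-congˡ (fromℕ-* N N)) ⟨
    fromℕ (8 ℕ.* (N ℕ.* N))        ≤⟨ fromℕ-mono-≤ 8NN≤2^k ⟩
    fromℕ (2 ℕ.^ k)                ≈⟨ fromℕ-2^ k ⟩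
    fromℕ 2 ^ℕ k                   ≤⟨ ^ℕ-monoˡ-≤ k (inj₁ 0<2) (≤-respʳ-≈ (*-congˡ (sym (*-identityʳ α))) 2≤αα) ⟩
    (α ^ℕ 2) ^ℕ k                  ≈⟨ ^ℕ-* α 2 k ⟩
    α ^ℕ (2 ℕ.* k)                 ≤⟨ ^ℕ-monoʳ-≤ (inj₁ 1<α) 2k≤N ⟩
    α ^ℕ N                         ∎
    where
    open ≤-Reasoning
    k = N ℕ./ 2
    j = k ℕ.∸ 14

    k≡14+j : 14 ℕ.+ j ≡ k
    k≡14+j = ℕ.m+[n∸m]≡n (ℕ./-monoˡ-≤ 2 28≤N)

    2k≤N : 2 ℕ.* k ℕ.≤ N
    2k≤N = ≡.subst (ℕ._≤ N) (ℕ.*-comm k 2) (ℕ.m/n*n≤m N 2)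

    N≤29+2j : N ℕ.≤ 29 ℕ.+ 2 ℕ.* j
    N≤29+2j = ≡.subst (ℕ._≤ 29 ℕ.+ 2 ℕ.* j) (≡.sym (ℕ.m≡m%n+[m/n]*n N 2)) (ℕ.≤-trans
      (ℕ.+-monoˡ-≤ (k ℕ.* 2) (ℕ.≤-pred (ℕ.m%n<n N 2)))
      (ℕ.≤-reflexive (≡.cong suc (≡.trans (≡.cong (ℕ._* 2) (≡.sym k≡14+j)) (double j)))))
      where
      double : ∀ j → (14 ℕ.+ j) ℕ.* 2 ≡ 28 ℕ.+ 2 ℕ.* j
      double = solve-∀

    8NN≤2^k : 8 ℕ.* (N ℕ.* N) ℕ.≤ 2 ℕ.^ k
    8NN≤2^k = ≡.subst (λ i → 8 ℕ.* (N ℕ.* N) ℕ.≤ 2 ℕ.^ i) k≡14+j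
      (ℕ.≤-trans (ℕ.*-monoʳ-≤ 8 (ℕ.*-mono-≤ N≤29+2j N≤29+2j)) (8[2k+1]²≤2^k j))

theorem1p3 : (ℝ : RealNumbers) →
    let open RealNumbers ℝ
        open PContinuedFraction ℝ
    in (a : ℕ) → 1 ℕ.≤ a →
       ∃ λ (M : ℕ) → (m : ℕ) → 1 ℕ.≤ m → M ℕ.≤ m →
       ∃ λ (p : Carrier) → 0# < p × p < 1# ×
         (∃₂ λ (r s : ℤ) →
            IsPConvergent p (metallicMean a) 0 r s ×
            ¬ (fromℤ s ≈ 0#) ×
            fromℤ r / fromℤ s ≈
              fromℕ (numerator (const a) m) / fromℕ (denominator (const a) m))
-- The threshold comes from N = m + 1 ≥ 36, the size at which g^N = 2 forces g⁴ < 9/8; growth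
-- already holds from N = 28 on.
theorem1p3 ℝ a 1≤a = 35 , λ m _ 35≤m →
  let N          = suc m
      36≤N       = s≤s 35≤m
      growth     = 8NN≤α^N N (ℕ.≤-trans (ℕ.m≤n+m 28 8) 36≤N)
      1<2        = <-respˡ-≈ fromℕ-1 (fromℕ-mono-< {1} {2} (s≤s (s≤s z≤n)))
      p , 0<p , p<1 , α^Np≈2 = logarithm 1<2 (2<α^ {N} (s≤s z≤n) growth)
  in p , 0<p , p<1 , + c (suc N) , + c N ,
     InitialConvergent.isPConvergent N 36≤N growth 0<p p<1 α^Np≈2 ,
     0<⇒≉0 (fromℕ-pos (1≤c m)) ,
     *-congˡ (⁻¹-cong (reflexive (≡.cong fromℕ (≡.sym (denominators≡c N)))))
  where
  open RealNumbers ℝ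
  open RealArithmetic ℝ
  open MetallicMean ℝ a 1≤a
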